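{- Let $G$ be a finite, simple, connected, undirected graph and let $\ell, m \ge 1$ be integers. If $G$ does not contain a complete bipartite subgraph $K_{\ell,m}$, then the index of its box complex $\mathsf{B}(G)$ satisfies $$\operatorname{ind}(\mathsf{B}(G)) \le \ell + m - 3 .$$
   Context: $V(G)$ is the node set of $G$. $K_{\ell,m}$ is the complete bipartite graph with parts of sizes $\ell$ and $m$; "contains" means as a (not necessarily induced) subgraph. Common neighborhood: for $A\subseteq V(G)$, $\mathrm{CN}(A)$ is the set of all nodes $v\in V(G)$ adjacent to every $a\in A$; in particular $\mathrm{CN}(\emptyset)=V(G)$. Neighborhood complex: $\mathsf{N}(G)$ is the abstract simplicial complex whose simplices are the sets $A\subseteq V(G)$ with $\mathrm{CN}(A)\neq\emptyset$. For sets $A,B$ put $A\uplus B := \{(a,0): a\in A\}\cup\{(b,1): b\in B\}$. Box complex: $\mathsf{B}(G) := \{A\uplus B : A,B\in \mathsf{N}(G),\ A\subseteq \mathrm{CN}(B),\ B\subseteq\mathrm{CN}(A)\}$ (either of $A,B$ may be empty). It is an abstract simplicial complex, with the simplicial free $\mathbb{Z}_2$-action $\nu$ which interchanges the two copies, $(v,0)\leftrightarrow(v,1)$, i.e. $A\uplus B\mapsto B\uplus A$. A $\mathbb{Z}_2$-space is a topological space $X$ with a self-inverse homeomorphism $\nu:X\to X$ without fixed points. The sphere $S^d$ is a $\mathbb{Z}_2$-space via the antipodal map $x\mapsto -x$. A $\mathbb{Z}_2$-map between $\mathbb{Z}_2$-spaces is a continuous map commuting with the actions. The index $\operatorname{ind}(X)$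 of a $\mathbb{Z}_2$-space $X$ is the smallest $d$ such that there is a $\mathbb{Z}_2$-map $X\to S^d$, with the usual convention $S^{ -1}=\emptyset$, so that the empty space has index $-1$. The index of a simplicial complex with a free simplicial $\mathbb{Z}_2$-action is the index of its geometric realization. -}

module Defs where

open import Algebra.Bundles using (CommutativeMonoid)
open import Data.Bool.Base using (not)
open import Data.Fin.Base using (Fin; splitAt; join; _↑ˡ_; _↑ʳ_)
open import Data.Fin.Permutation using (Permutation′; permutation)
open import Data.Fin.Properties using (sequence; splitAt-join; join-splitAt)
open import Data.Fin.Subset using (Subset; inside; _∈_; _∉_; _⊆_; Nonempty)
open import Data.Fin.Subset.Properties using (_∈?_; nonempty?)
open import Data.Integer.Base as ℤ using (ℤ; _⊖_)
import Data.Integer.Properties as ℤ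
open import Data.Nat.Base as ℕ using (ℕ)
import Data.Nat.Induction as ℕ
import Data.Nat.Properties as ℕ
open import Data.Product.Base using (Σ; ∃; ∃₂; _×_; _,_; proj₁; proj₂)
open import Data.Rational.Base as ℚ using (ℚ; 0ℚ; 1ℚ; _+_; _*_; -_; _-_; ∣_∣; _<_; 1/_)
import Data.Rational.Properties as ℚ
open import Data.Rational.Solver using (module +-*-Solver)
open import Data.Sum.Base as Sum using (_⊎_; inj₁; inj₂; [_,_]′)
open import Data.Sum.Properties using (swap-involutive)
open import Data.Vec.Base using (lookup; tabulate; take; drop; _++_)
open import Data.Vec.Properties
  using (lookup∘tabulate; tabulate∘lookup; tabulate-cong; lookup⇒[]=; []=⇒lookup;
         lookup-splitAt; lookup-++ˡ; lookup-++ʳ; take++drop≡id; ++-injectiveˡ; ++-injectiveʳ)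
open import Effect.Monad using (RawMonad)
open import Function.Base using (_∘_; case_of_)
open import Function.Bundles using (Func; _⇔_; mk⇔)
open import Function.Definitions using (Injective)
open import Induction.WellFounded using (Acc; acc)
open import Level using (0ℓ)
open import Relation.Binary.Bundles using (Setoid)
open import Relation.Binary.Construct.Closure.ReflexiveTransitive using (Star)
open import Relation.Binary.Core using (Rel)
open import Relation.Binary.Definitions using (Symmetric; Irreflexive; Decidable; _Respects_)
open import Relation.Binary.PropositionalEquality
  using (_≡_; refl; sym; trans; cong; cong₂; subst; subst₂)
open import Relation.Nullary using (¬_; Dec; yes; no; contradiction; does)
open import Relation.Nullary.Decidable using (¬¬-excluded-middle)
open import Relation.Nullary.Negation using (¬¬-Monad)
open import Relation.Unary using (Pred; U; _∩_; ⋃; _≐_; _⊢_; Satisfiable)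

dist-refl : ∀ p → ∣ p - p ∣ ≡ 0ℚ
dist-refl p = cong ∣_∣ (ℚ.+-inverseʳ p)

dist-sym : ∀ p q → ∣ p - q ∣ ≡ ∣ q - p ∣
dist-sym p q = trans (cong ∣_∣ (lemma p q)) (ℚ.∣-p∣≡∣p∣ (q - p))
  where
  open +-*-Solver
  lemma : ∀ p q → p - q ≡ - (q - p)
  lemma = solve 2 (λ p q → p :- q := :- (q :- p)) refl

dist-triangle : ∀ p q r → ∣ p - r ∣ ℚ.≤ ∣ p - q ∣ + ∣ q - r ∣
dist-triangle p q r =
  subst (λ s → ∣ s ∣ ℚ.≤ ∣ p - q ∣ + ∣ q - r ∣) (lemma p q r) (ℚ.∣p+q∣≤∣p∣+∣q∣ (p - q) (q - r))
  where
  open +-*-Solver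
  lemma : ∀ p q r → (p - q) + (q - r) ≡ p - r
  lemma = solve 3 (λ p q r → (p :- q) :+ (q :- r) := p :- r) refl

dist-+ : ∀ p q r s → ∣ (p + q) - (r + s) ∣ ℚ.≤ ∣ p - r ∣ + ∣ q - s ∣
dist-+ p q r s =
  subst (λ t → ∣ t ∣ ℚ.≤ ∣ p - r ∣ + ∣ q - s ∣) (lemma p q r s) (ℚ.∣p+q∣≤∣p∣+∣q∣ (p - r) (q - s))
  where
  open +-*-Solver
  lemma : ∀ p q r s → (p - r) + (q - s) ≡ (p + q) - (r + s)
  lemma = solve 4 (λ p q r s → (p :- r) :+ (q :- s) := (p :+ q) :- (r :+ s)) refl

dist-* : ∀ p q r s → ∣ (p * q) - (r * s) ∣ ℚ.≤ ∣ p ∣ * ∣ q - s ∣ + ∣ s ∣ * ∣ p - r ∣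
dist-* p q r s =
  subst₂ ℚ._≤_ (cong ∣_∣ (lemma p q r s))
    (cong₂ _+_ (ℚ.∣p*q∣≡∣p∣*∣q∣ p (q - s)) (ℚ.∣p*q∣≡∣p∣*∣q∣ s (p - r)))
    (ℚ.∣p+q∣≤∣p∣+∣q∣ (p * (q - s)) (s * (p - r)))
  where
  open +-*-Solver
  lemma : ∀ p q r s → p * (q - s) + s * (p - r) ≡ (p * q) - (r * s)
  lemma = solve 4 (λ p q r s → p :* (q :- s) :+ s :* (p :- r) := (p :* q) :- (r :* s)) refl

dist-neg : ∀ p q → ∣ (- p) - (- q) ∣ ≡ ∣ p - q ∣
dist-neg p q = trans (cong ∣_∣ (lemma p q)) (ℚ.∣-p∣≡∣p∣ (p - q))
  where
  open +-*-Solver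
  lemma : ∀ p q → (- p) - (- q) ≡ - (p - q)
  lemma = solve 2 (λ p q → (:- p) :- (:- q) := :- (p :- q)) refl

∣p∣≤∣q∣+dist : ∀ p q → ∣ p ∣ ℚ.≤ ∣ q ∣ + ∣ p - q ∣
∣p∣≤∣q∣+dist p q =
  subst (λ s → ∣ s ∣ ℚ.≤ ∣ q ∣ + ∣ p - q ∣) (lemma p q) (ℚ.∣p+q∣≤∣p∣+∣q∣ q (p - q))
  where
  open +-*-Solver
  lemma : ∀ p q → q + (p - q) ≡ p
  lemma = solve 2 (λ p q → q :+ (p :- q) := p) refl

∣p∣-∣q∣≤dist : ∀ p q → ∣ p ∣ - ∣ q ∣ ℚ.≤ ∣ p - q ∣
∣p∣-∣q∣≤dist p q = subst (∣ p ∣ - ∣ q ∣ ℚ.≤_) (cancel ∣ q ∣ ∣ p - q ∣)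
  (ℚ.+-monoˡ-≤ (- ∣ q ∣) (∣p∣≤∣q∣+dist p q))
  where
  open +-*-Solver
  cancel : ∀ a d → (a + d) - a ≡ d
  cancel = solve 2 (λ a d → (a :+ d) :- a := d) refl

dist-∣∣ : ∀ p q → ∣ ∣ p ∣ - ∣ q ∣ ∣ ℚ.≤ ∣ p - q ∣
dist-∣∣ p q with ℚ.∣p∣≡p∨∣p∣≡-p (∣ p ∣ - ∣ q ∣)
... | inj₁ eq = subst (ℚ._≤ ∣ p - q ∣) (sym eq) (∣p∣-∣q∣≤dist p q)
... | inj₂ eq =
  subst₂ ℚ._≤_ (sym (trans eq (flip ∣ p ∣ ∣ q ∣))) (dist-sym q p) (∣p∣-∣q∣≤dist q p)
  where
  open +-*-Solver
  flip : ∀ a b → - (a - b) ≡ b - a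
  flip = solve 2 (λ a b → :- (a :- b) := b :- a) refl

divide : ∀ {M ε} → 0ℚ < M → 0ℚ < ε → ∃ λ δ → 0ℚ < δ × M * δ ≡ ε
divide {M} {ε} 0<M 0<ε = 1/ M * ε , ℚ.positive⁻¹ _ , eq
  where
  instance
    M-pos : ℚ.Positive M
    M-pos = ℚ.positive 0<M
    ε-pos : ℚ.Positive ε
    ε-pos = ℚ.positive 0<ε
    M-nonZero : ℚ.NonZero M
    M-nonZero = ℚ.pos⇒nonZero M
    1/M-pos : ℚ.Positive (1/ M)
    1/M-pos = ℚ.1/pos⇒pos M
    δ-pos : ℚ.Positive (1/ M * ε)
    δ-pos = ℚ.pos*pos⇒pos (1/ M) ε
  eq : M * (1/ M * ε) ≡ ε
  eq = trans (sym (ℚ.*-assoc M (1/ M) ε))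
         (trans (cong (_* ε) (ℚ.*-inverseʳ M)) (ℚ.*-identityˡ ε))

halve : ∀ {ε} → 0ℚ < ε → ∃ λ δ → 0ℚ < δ × δ + δ ≡ ε
halve 0<ε with divide {1ℚ + 1ℚ} (ℚ.positive⁻¹ (1ℚ + 1ℚ)) 0<ε
... | δ , 0<δ , eq = δ , 0<δ , trans (sym (lemma δ)) eq
  where
  open +-*-Solver
  lemma : ∀ δ → (1ℚ + 1ℚ) * δ ≡ δ + δ
  lemma = solve 1 (λ δ → (con 1ℚ :+ con 1ℚ) :* δ := δ :+ δ) refl

dist-+-< : ∀ p q r s {δ ε} → δ + δ ≡ ε → ∣ p - r ∣ < δ → ∣ q - s ∣ < δ →
           ∣ (p + q) - (r + s) ∣ < ε
dist-+-< p q r s {δ} δ+δ≡ε p≈r q≈s = ℚ.≤-<-trans (dist-+ p q r s)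
  (subst (∣ p - r ∣ + ∣ q - s ∣ <_) δ+δ≡ε
    (ℚ.+-mono-< {∣ p - r ∣} {δ} {∣ q - s ∣} {δ} p≈r q≈s))

dist-triangle-< : ∀ p q r {δ ε} → δ + δ ≡ ε → ∣ p - q ∣ < δ → ∣ q - r ∣ < δ → ∣ p - r ∣ < ε
dist-triangle-< p q r {δ} δ+δ≡ε p≈q q≈r = ℚ.≤-<-trans (dist-triangle p q r)
  (subst (∣ p - q ∣ + ∣ q - r ∣ <_) δ+δ≡ε
    (ℚ.+-mono-< {∣ p - q ∣} {δ} {∣ q - r ∣} {δ} p≈q q≈r))

gap : ∀ {δ ε} d → δ + δ ≡ ε → d < δ → δ < ε - d
gap {δ} {ε} d δ+δ≡ε d<δ = subst (_< ε - d) (trans (cong (_- δ) (sym δ+δ≡ε)) (lemma δ))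
  (ℚ.+-monoʳ-< ε { - δ} { - d} (ℚ.neg-antimono-< {d} {δ} d<δ))
  where
  open +-*-Solver
  lemma : ∀ δ → (δ + δ) - δ ≡ δ
  lemma = solve 1 (λ δ → (δ :+ δ) :- δ := δ) refl

0<1 : 0ℚ < 1ℚ
0<1 = ℚ.positive⁻¹ 1ℚ

Eventually : Pred ℕ 0ℓ → Set
Eventually P = ∃ λ N → ∀ n → N ℕ.≤ n → P n

eventually-map : {P Q : Pred ℕ 0ℓ} → (∀ n → P n → Q n) → Eventually P → Eventually Q
eventually-map f (N , p) = N , λ n N≤n → f n (p n N≤n)

eventually-zip : {P Q R : Pred ℕ 0ℓ} → (∀ n → P n → Q n → R n) →
                 Eventually P → Eventually Q → Eventually R
eventually-zip f (M , p) (N , q) = M ℕ.⊔ N , λ n M⊔N≤n →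
  f n (p n (ℕ.≤-trans (ℕ.m≤m⊔n M N) M⊔N≤n)) (q n (ℕ.≤-trans (ℕ.m≤n⊔m M N) M⊔N≤n))

eventually⇒∃ : {P : Pred ℕ 0ℓ} → Eventually P → ∃ P
eventually⇒∃ (N , p) = N , p N ℕ.≤-refl

IsCauchyWithin : ℚ → (ℕ → ℚ) → Set
IsCauchyWithin ε p = ∃ λ N → ∀ m n → N ℕ.≤ m → N ℕ.≤ n → ∣ p m - p n ∣ < ε

record ℝ : Set where
  field
    seq    : ℕ → ℚ
    cauchy : ∀ ε → 0ℚ < ε → IsCauchyWithin ε seq

open ℝ public

infix  4 _≈ℝ_ _≤ℝ_ _<ℝ_
infixl 6 _+ℝ_ _-ℝ_
infixl 7 _*ℝ_
infix  8 -ℝ_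

_≈ℝ_ : Rel ℝ 0ℓ
x ≈ℝ y = ∀ ε → 0ℚ < ε → Eventually λ n → ∣ seq x n - seq y n ∣ < ε

_≤ℝ_ : Rel ℝ 0ℓ
x ≤ℝ y = ∀ ε → 0ℚ < ε → Eventually λ n → seq x n - seq y n < ε

_<ℝ_ : Rel ℝ 0ℓ
x <ℝ y = ∃ λ ε → 0ℚ < ε × Eventually λ n → ε < seq y n - seq x n

fromℚ : ℚ → ℝ
fromℚ p = record
  { seq    = λ _ → p
  ; cauchy = λ ε 0<ε → 0 , λ _ _ _ _ → subst (_< ε) (sym (dist-refl p)) 0<ε
  }

0ℝ 1ℝ : ℝ
0ℝ = fromℚ 0ℚ
1ℝ = fromℚ 1ℚ

_+ℝ_ : ℝ → ℝ → ℝ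
seq    (x +ℝ y) n = seq x n + seq y n
cauchy (x +ℝ y) ε 0<ε =
  let δ , 0<δ , δ+δ≡ε = halve 0<ε
      M , p = cauchy x δ 0<δ
      N , q = cauchy y δ 0<δ
  in M ℕ.⊔ N , λ m n ≤m ≤n → dist-+-< (seq x m) (seq y m) (seq x n) (seq y n) δ+δ≡ε
      (p m n (ℕ.≤-trans (ℕ.m≤m⊔n M N) ≤m) (ℕ.≤-trans (ℕ.m≤m⊔n M N) ≤n))
      (q m n (ℕ.≤-trans (ℕ.m≤n⊔m M N) ≤m) (ℕ.≤-trans (ℕ.m≤n⊔m M N) ≤n))

-ℝ_ : ℝ → ℝ
seq    (-ℝ x) n = - seq x n
cauchy (-ℝ x) ε 0<ε =
  let N , p = cauchy x ε 0<ε
  in N , λ m n ≤m ≤n → subst (_< ε) (sym (dist-neg (seq x m) (seq x n))) (p m n ≤m ≤n)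

_-ℝ_ : ℝ → ℝ → ℝ
x -ℝ y = x +ℝ (-ℝ y)

∣_∣ℝ : ℝ → ℝ
seq    ∣ x ∣ℝ n = ∣ seq x n ∣
cauchy ∣ x ∣ℝ ε 0<ε =
  let N , p = cauchy x ε 0<ε
  in N , λ m n ≤m ≤n → ℚ.≤-<-trans (dist-∣∣ (seq x m) (seq x n)) (p m n ≤m ≤n)

bounded : ∀ x → ∃ λ B → 0ℚ < B × Eventually λ n → ∣ seq x n ∣ < B
bounded x =
  let N , p = cauchy x 1ℚ 0<1
  in ∣ seq x N ∣ + 1ℚ
   , ℚ.+-mono-≤-< {0ℚ} {∣ seq x N ∣} {0ℚ} {1ℚ} (ℚ.0≤∣p∣ (seq x N)) 0<1
   , N , λ n N≤n → ℚ.≤-<-trans (∣p∣≤∣q∣+dist (seq x n) (seq x N))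
       (ℚ.+-monoʳ-< ∣ seq x N ∣ {∣ seq x n - seq x N ∣} {1ℚ} (p n N N≤n ℕ.≤-refl))

*-bound : ∀ {B δ} → 0ℚ < B → ∀ {p d} → ∣ p ∣ < B → ∣ d ∣ < δ → ∣ p ∣ * ∣ d ∣ < B * δ
*-bound {B} 0<B {p} {d} p<B d<δ =
  ℚ.≤-<-trans (ℚ.*-monoʳ-≤-nonNeg ∣ d ∣ {{ℚ.∣-∣-nonNeg d}} (ℚ.<⇒≤ p<B))
              (ℚ.*-monoʳ-<-pos B {{ℚ.positive 0<B}} d<δ)

*-cauchy : ∀ (p q : ℕ → ℚ) {A B δ ε} → 0ℚ < A → 0ℚ < B → (A + B) * δ ≡ ε →
           Eventually (λ n → ∣ p n ∣ < A) → Eventually (λ n → ∣ q n ∣ < B) →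
           IsCauchyWithin δ p → IsCauchyWithin δ q →
           IsCauchyWithin ε (λ n → p n * q n)
*-cauchy p q {A} {B} {δ} {ε} 0<A 0<B eq (I , pA) (J , qB) (M , p-cauchy) (N , q-cauchy) =
  (I ℕ.⊔ J) ℕ.⊔ (M ℕ.⊔ N) , λ m n ≤m ≤n →
    ℚ.≤-<-trans (dist-* (p m) (q m) (p n) (q n))
      (subst (∣ p m ∣ * ∣ q m - q n ∣ + ∣ q n ∣ * ∣ p m - p n ∣ <_)
        (trans (sym (ℚ.*-distribʳ-+ δ A B)) eq)
        (ℚ.+-mono-<
          (*-bound 0<A {p m} {q m - q n} (pA m (ℕ.≤-trans I≤ ≤m))
            (q-cauchy m n (ℕ.≤-trans N≤ ≤m) (ℕ.≤-trans N≤ ≤n)))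
          (*-bound 0<B {q n} {p m - p n} (qB n (ℕ.≤-trans J≤ ≤n))
            (p-cauchy m n (ℕ.≤-trans M≤ ≤m) (ℕ.≤-trans M≤ ≤n)))))
  where
  I≤ : I ℕ.≤ (I ℕ.⊔ J) ℕ.⊔ (M ℕ.⊔ N)
  I≤ = ℕ.≤-trans (ℕ.m≤m⊔n I J) (ℕ.m≤m⊔n (I ℕ.⊔ J) (M ℕ.⊔ N))
  J≤ : J ℕ.≤ (I ℕ.⊔ J) ℕ.⊔ (M ℕ.⊔ N)
  J≤ = ℕ.≤-trans (ℕ.m≤n⊔m I J) (ℕ.m≤m⊔n (I ℕ.⊔ J) (M ℕ.⊔ N))
  M≤ : M ℕ.≤ (I ℕ.⊔ J) ℕ.⊔ (M ℕ.⊔ N)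
  M≤ = ℕ.≤-trans (ℕ.m≤m⊔n M N) (ℕ.m≤n⊔m (I ℕ.⊔ J) (M ℕ.⊔ N))
  N≤ : N ℕ.≤ (I ℕ.⊔ J) ℕ.⊔ (M ℕ.⊔ N)
  N≤ = ℕ.≤-trans (ℕ.m≤n⊔m M N) (ℕ.m≤n⊔m (I ℕ.⊔ J) (M ℕ.⊔ N))

_*ℝ_ : ℝ → ℝ → ℝ
seq    (x *ℝ y) n = seq x n * seq y n
cauchy (x *ℝ y) ε 0<ε =
  let A , 0<A , xA   = bounded x
      B , 0<B , yB   = bounded y
      δ , 0<δ , eq   = divide {A + B} {ε} (ℚ.+-mono-< {0ℚ} {A} {0ℚ} {B} 0<A 0<B) 0<ε
  in *-cauchy (seq x) (seq y) {A} {B} {δ} {ε} 0<A 0<B eq xA yB (cauchy x δ 0<δ) (cauchy y δ 0<δ)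

≗⇒≈ℝ : ∀ {x y} → (∀ n → seq x n ≡ seq y n) → x ≈ℝ y
≗⇒≈ℝ {x} {y} eq ε 0<ε = 0 , λ n _ →
  subst (_< ε) (sym (trans (cong (λ p → ∣ p - seq y n ∣) (eq n)) (dist-refl (seq y n)))) 0<ε

≈ℝ-refl : ∀ {x} → x ≈ℝ x
≈ℝ-refl {x} = ≗⇒≈ℝ {x} {x} (λ _ → refl)

≈ℝ-sym : ∀ {x y} → x ≈ℝ y → y ≈ℝ x
≈ℝ-sym {x} {y} x≈y ε 0<ε =
  eventually-map (λ n → subst (_< ε) (dist-sym (seq x n) (seq y n))) (x≈y ε 0<ε)

≈ℝ-trans : ∀ {x y z} → x ≈ℝ y → y ≈ℝ z → x ≈ℝ z
≈ℝ-trans {x} {y} {z} x≈y y≈z ε 0<ε =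
  let δ , 0<δ , δ+δ≡ε = halve 0<ε
  in eventually-zip (λ n → dist-triangle-< (seq x n) (seq y n) (seq z n) δ+δ≡ε)
       (x≈y δ 0<δ) (y≈z δ 0<δ)

ℝ-setoid : Setoid 0ℓ 0ℓ
ℝ-setoid = record
  { Carrier       = ℝ
  ; _≈_           = _≈ℝ_
  ; isEquivalence = record
    { refl  = λ {x} → ≈ℝ-refl {x}
    ; sym   = λ {x} {y} → ≈ℝ-sym {x} {y}
    ; trans = λ {x} {y} {z} → ≈ℝ-trans {x} {y} {z}
    }
  }

+ℝ-cong : ∀ {x y u v} → x ≈ℝ y → u ≈ℝ v → x +ℝ u ≈ℝ y +ℝ v
+ℝ-cong {x} {y} {u} {v} x≈y u≈v ε 0<ε =
  let δ , 0<δ , δ+δ≡ε = halve 0<ε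
  in eventually-zip (λ n → dist-+-< (seq x n) (seq u n) (seq y n) (seq v n) δ+δ≡ε)
       (x≈y δ 0<δ) (u≈v δ 0<δ)

-ℝ-cong : ∀ {x y} → x ≈ℝ y → -ℝ x ≈ℝ -ℝ y
-ℝ-cong {x} {y} x≈y ε 0<ε =
  eventually-map (λ n → subst (_< ε) (sym (dist-neg (seq x n) (seq y n)))) (x≈y ε 0<ε)

+ℝ-0-commutativeMonoid : CommutativeMonoid 0ℓ 0ℓ
+ℝ-0-commutativeMonoid = record
  { Carrier = ℝ
  ; _≈_     = _≈ℝ_
  ; _∙_     = _+ℝ_
  ; ε       = 0ℝ
  ; isCommutativeMonoid = record
    { isMonoid = record
      { isSemigroup = record
        { isMagma = record
          { isEquivalence = Setoid.isEquivalence ℝ-setoid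
          ; ∙-cong        = λ {x} {y} {u} {v} → +ℝ-cong {x} {y} {u} {v}
          }
        ; assoc = λ x y z → ≗⇒≈ℝ {(x +ℝ y) +ℝ z} {x +ℝ (y +ℝ z)}
            (λ n → ℚ.+-assoc (seq x n) (seq y n) (seq z n))
        }
      ; identity = (λ x → ≗⇒≈ℝ {0ℝ +ℝ x} {x} (λ n → ℚ.+-identityˡ (seq x n)))
                 , (λ x → ≗⇒≈ℝ {x +ℝ 0ℝ} {x} (λ n → ℚ.+-identityʳ (seq x n)))
      }
    ; comm = λ x y → ≗⇒≈ℝ {x +ℝ y} {y +ℝ x} (λ n → ℚ.+-comm (seq x n) (seq y n))
    }
  }

open import Algebra.Properties.CommutativeMonoid.Sum +ℝ-0-commutativeMonoid public
  using (sum; sum-cong-≋; sum-permute; sum-replicate-zero)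

1ℝ≉0ℝ : ¬ 1ℝ ≈ℝ 0ℝ
1ℝ≉0ℝ 1≈0 with 1≈0 1ℚ 0<1
... | N , p = ℚ.<-irrefl refl (p N ℕ.≤-refl)

sum-zero : ∀ {k} {x : Fin k → ℝ} → (∀ i → x i ≈ℝ 0ℝ) → sum x ≈ℝ 0ℝ
sum-zero {k} {x} x≈0 =
  ≈ℝ-trans {sum x} {sum (λ (_ : Fin k) → 0ℝ)} {0ℝ} (sum-cong-≋ {x = x} x≈0) (sum-replicate-zero k)

sq-zero : ∀ x → x ≈ℝ 0ℝ → x *ℝ x ≈ℝ 0ℝ
sq-zero x x≈0 ε 0<ε = eventually-zip
  (λ n p q → subst₂ _<_ (sym (lemma (seq x n))) (ℚ.*-identityˡ ε)
     (*-bound 0<1 {seq x n} {seq x n} (subst (λ r → ∣ r ∣ < 1ℚ) (ℚ.+-identityʳ (seq x n)) p)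
                  (subst (λ r → ∣ r ∣ < ε) (ℚ.+-identityʳ (seq x n)) q)))
  (x≈0 1ℚ 0<1) (x≈0 ε 0<ε)
  where
  lemma : ∀ p → ∣ p * p - 0ℚ ∣ ≡ ∣ p ∣ * ∣ p ∣
  lemma p = trans (cong ∣_∣ (ℚ.+-identityʳ (p * p))) (ℚ.∣p*q∣≡∣p∣*∣q∣ p p)

self-negative⇒zero : ∀ x → -ℝ x ≈ℝ x → x ≈ℝ 0ℝ
self-negative⇒zero x -x≈x ε 0<ε =
  eventually-map (λ n → ℚ.≤-<-trans (lemma (seq x n))) (-x≈x ε 0<ε)
  where
  open +-*-Solver
  eq : ∀ p → (- p) - p ≡ - (p + p)
  eq = solve 1 (λ p → (:- p) :- p := :- (p :+ p)) refl
  double : ∀ p → p + p ≡ (1ℚ + 1ℚ) * p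
  double = solve 1 (λ p → p :+ p := (con 1ℚ :+ con 1ℚ) :* p) refl
  double′ : ∀ p → (1ℚ + 1ℚ) * p ≡ p + p
  double′ p = sym (double p)
  lemma : ∀ p → ∣ p - 0ℚ ∣ ℚ.≤ ∣ (- p) - p ∣
  lemma p = subst₂ ℚ._≤_
    (trans (ℚ.+-identityʳ ∣ p ∣) (cong ∣_∣ (sym (ℚ.+-identityʳ p))))
    (sym (trans (cong ∣_∣ (eq p)) (trans (ℚ.∣-p∣≡∣p∣ (p + p))
      (trans (cong ∣_∣ (double p)) (trans (ℚ.∣p*q∣≡∣p∣*∣q∣ (1ℚ + 1ℚ) p) (double′ ∣ p ∣))))))
    (ℚ.+-monoʳ-≤ ∣ p ∣ (ℚ.0≤∣p∣ p))

record TopologicalSpace : Set₁ where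
  field
    points : Setoid 0ℓ 0ℓ

  open Setoid points public using (Carrier; _≈_)

  field
    IsOpen   : Pred Carrier 0ℓ → Set
    resp-≐   : ∀ {V W} → V ≐ W → IsOpen V → IsOpen W
    resp-≈   : ∀ {V} → IsOpen V → V Respects _≈_
    open-U   : IsOpen U
    open-∩   : ∀ {V W} → IsOpen V → IsOpen W → IsOpen (V ∩ W)
    open-⋃   : ∀ {I : Set} {V : I → Pred Carrier 0ℓ} → (∀ i → IsOpen (V i)) → IsOpen (⋃ I V)

record ContinuousMap (X Y : TopologicalSpace) : Set₁ where
  private
    module X = TopologicalSpace X
    module Y = TopologicalSpace Y
  field
    func : Func X.points Y.points
  open Func func public using (to; cong)
  field
    continuous : ∀ {V} → Y.IsOpen V → X.IsOpen (to ⊢ V)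

record ℤ₂-Space : Set₁ where
  field
    space : TopologicalSpace
  open TopologicalSpace space public
  field
    ν            : ContinuousMap space space
  open ContinuousMap ν public using () renaming (to to act)
  field
    ν-involutive : ∀ x → act (act x) ≈ x
    ν-free       : ∀ x → ¬ act x ≈ x

record ℤ₂-Map (X Y : ℤ₂-Space) : Set₁ where
  private
    module X = ℤ₂-Space X
    module Y = ℤ₂-Space Y
  field
    map : ContinuousMap X.space Y.space
  open ContinuousMap map public
  field
    equivariant : ∀ x → to (X.act x) Y.≈ Y.act (to x)

-- The maximum metric induces the Euclidean topology.
Near : ∀ {k} → ℚ → Rel (Fin k → ℝ) 0ℓ
Near ε x y = ∀ i → ∣ x i -ℝ y i ∣ℝ <ℝ fromℚ ε

near-≈ : ∀ {k} {x y : Fin k → ℝ} {ε} → 0ℚ < ε → (∀ i → x i ≈ℝ y i) → Near ε x y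
near-≈ {x = x} {y} {ε} 0<ε x≈y i =
  let δ , 0<δ , δ+δ≡ε = halve 0<ε
  in δ , 0<δ , eventually-map (λ n → gap ∣ seq (x i) n - seq (y i) n ∣ δ+δ≡ε) (x≈y i δ 0<δ)

near-mono : ∀ {k} {x y : Fin k → ℝ} {δ ε} → δ ℚ.≤ ε → Near δ x y → Near ε x y
near-mono {x = x} {y} {δ} {ε} δ≤ε near i =
  let η , 0<η , η<δ-d = near i
  in η , 0<η , eventually-map
       (λ n p → ℚ.<-≤-trans p (ℚ.+-monoˡ-≤ (- ∣ seq (x i) n - seq (y i) n ∣) {δ} {ε} δ≤ε)) η<δ-d

subspace : ∀ {k} → Pred (Fin k → ℝ) 0ℓ → TopologicalSpace
subspace {k} P = record
  { points = record
    { Carrier       = Σ (Fin k → ℝ) P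
    ; _≈_           = λ x y → ∀ i → proj₁ x i ≈ℝ proj₁ y i
    ; isEquivalence = record
      { refl  = λ {x} i → ≈ℝ-refl {proj₁ x i}
      ; sym   = λ {x} {y} x≈y i → ≈ℝ-sym {proj₁ x i} {proj₁ y i} (x≈y i)
      ; trans = λ {x} {y} {z} x≈y y≈z i →
                  ≈ℝ-trans {proj₁ x i} {proj₁ y i} {proj₁ z i} (x≈y i) (y≈z i)
      }
    }
  ; IsOpen = λ V → ∀ x → V x → ∃ λ ε → 0ℚ < ε × (∀ y → Near ε (proj₁ x) (proj₁ y) → V y)
  ; resp-≐ = λ (V⊆W , W⊆V) V-open x Wx → case V-open x (W⊆V Wx) of λ
      (ε , 0<ε , ball) → ε , 0<ε , λ y near → V⊆W (ball y near)
  ; resp-≈ = λ V-open {x} {y} x≈y Vx → case V-open x Vx of λ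
      (ε , 0<ε , ball) → ball y (near-≈ {x = proj₁ x} {proj₁ y} 0<ε x≈y)
  ; open-U = λ _ _ → 1ℚ , 0<1 , λ _ _ → _
  ; open-∩ = λ V-open W-open x (Vx , Wx) → case V-open x Vx , W-open x Wx of λ
      ((δ , 0<δ , inV) , (ε , 0<ε , inW)) → case ℚ.≤-total δ ε of λ
        { (inj₁ δ≤ε) → δ , 0<δ , λ y near →
            inV y near , inW y (near-mono {x = proj₁ x} {proj₁ y} δ≤ε near)
        ; (inj₂ ε≤δ) → ε , 0<ε , λ y near →
            inV y (near-mono {x = proj₁ x} {proj₁ y} ε≤δ near) , inW y near
        }
  ; open-⋃ = λ V-open x (i , Vx) → case V-open i x Vx of λ
      (ε , 0<ε , ball) → ε , 0<ε , λ y near → i , ball y near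
  }

-- The unit sphere of ℝᵏ is the sphere of dimension k - 1; it is empty for k = 0.
UnitSphere : ℕ → ℤ₂-Space
UnitSphere k = record
  { space = subspace OnSphere
  ; ν = record
    { func = record
      { to   = λ (x , x∈S) → (λ i → -ℝ x i) ,
          ≈ℝ-trans {sum (λ i → (-ℝ x i) *ℝ (-ℝ x i))} {sum (λ i → x i *ℝ x i)} {1ℝ}
            (sum-cong-≋ {x = λ i → (-ℝ x i) *ℝ (-ℝ x i)} {y = λ i → x i *ℝ x i}
              (λ i → ≗⇒≈ℝ {(-ℝ x i) *ℝ (-ℝ x i)} {x i *ℝ x i} (λ n → neg-sq (seq (x i) n))))
            x∈S
      ; cong = λ {x} {y} x≈y i → -ℝ-cong {proj₁ x i} {proj₁ y i} (x≈y i)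
      }
    ; continuous = λ V-open (x , _) V[-x] → case V-open _ V[-x] of λ
        (ε , 0<ε , ball) → ε , 0<ε , λ (y , _) near → ball _ (λ i → case near i of λ
          (η , 0<η , ev) → η , 0<η , eventually-map
            (λ n → subst (λ d → η < ε - d) (sym (dist-neg (seq (x i) n) (seq (y i) n)))) ev)
    }
  ; ν-involutive = λ (x , _) i →
      ≗⇒≈ℝ { -ℝ (-ℝ x i)} {x i} (λ n → neg-neg (seq (x i) n))
  ; ν-free = λ (x , x∈S) -x≈x → 1ℝ≉0ℝ
      (≈ℝ-trans {1ℝ} {sum (λ i → x i *ℝ x i)} {0ℝ}
        (≈ℝ-sym {sum (λ i → x i *ℝ x i)} {1ℝ} x∈S)
        (sum-zero (λ i → sq-zero (x i) (self-negative⇒zero (x i) (-x≈x i)))))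
  }
  where
  open +-*-Solver

  OnSphere : Pred (Fin k → ℝ) 0ℓ
  OnSphere x = sum (λ i → x i *ℝ x i) ≈ℝ 1ℝ

  neg-sq : ∀ p → (- p) * (- p) ≡ p * p
  neg-sq = solve 1 (λ p → (:- p) :* (:- p) := p :* p) refl

  neg-neg : ∀ p → - (- p) ≡ p
  neg-neg = solve 1 (λ p → :- (:- p) := p) refl

MapsToSphere : ℤ₂-Space → ℤ → Set₁
MapsToSphere X d = ∃ λ k → k ⊖ 1 ≡ d × ℤ₂-Map X (UnitSphere k)

IsIndex : ℤ₂-Space → ℤ → Set₁
IsIndex X d = MapsToSphere X d × (∀ e → MapsToSphere X e → d ℤ.≤ e)

-- A least d cannot be computed from a map to some sphere, so the index is
-- handled through its upper bounds; the two lemmas after this definition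
-- relate them to the least d.
ind_≤_ : ℤ₂-Space → ℤ → Set₁
ind X ≤ e = ∃ λ d → d ℤ.≤ e × MapsToSphere X d

infix 4 ind_≤_

isIndex⇒[ind≤⇔≤] : ∀ {X d e} → IsIndex X d → ind X ≤ e ⇔ d ℤ.≤ e
isIndex⇒[ind≤⇔≤] {X} {d} {e} (mapsTo-d , d-least) = mk⇔
  (λ (d′ , d′≤e , mapsTo-d′) → ℤ.≤-trans (d-least d′ mapsTo-d′) d′≤e)
  (λ d≤e → d , d≤e , mapsTo-d)

ind≤⇒¬¬isIndex : ∀ {X e} → ind X ≤ e → ¬ ¬ ∃ λ d → IsIndex X d × d ℤ.≤ e
ind≤⇒¬¬isIndex {X} {e} (_ , d≤e , k , refl , f) = go k (ℕ.<-wellFounded k) f d≤e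
  where
  go : ∀ k → Acc ℕ._<_ k → ℤ₂-Map X (UnitSphere k) → k ⊖ 1 ℤ.≤ e →
       ¬ ¬ ∃ λ d → IsIndex X d × d ℤ.≤ e
  go k (acc rs) f k⊖1≤e no-index = no-index
    (k ⊖ 1 , ((k , refl , f) , least) , k⊖1≤e)
    where
    least : ∀ d → MapsToSphere X d → k ⊖ 1 ℤ.≤ d
    least _ (j , refl , g) with k ℕ.≤? j
    ... | yes k≤j = ℤ.⊖-monoˡ-≤ 1 k≤j
    ... | no  k≰j = contradiction no-index (go j (rs (ℕ.≰⇒> k≰j)) g
                      (ℤ.≤-trans (ℤ.⊖-monoˡ-≤ 1 (ℕ.<⇒≤ (ℕ.≰⇒> k≰j))) k⊖1≤e))

record SimplicialComplex : Set₁ where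
  field
    vertices   : ℕ
    IsSimplex  : Pred (Subset vertices) 0ℓ
    downClosed : ∀ {σ τ} → τ ⊆ σ → IsSimplex σ → IsSimplex τ

-- The image of σ under an involution ν of the vertices, written as a preimage.
image : ∀ {n} → (Fin n → Fin n) → Subset n → Subset n
image ν σ = tabulate (λ v → lookup σ (ν v))

record FreeInvolution (K : SimplicialComplex) : Set where
  open SimplicialComplex K
  field
    ν          : Fin vertices → Fin vertices
    involutive : ∀ v → ν (ν v) ≡ v
    simplicial : ∀ {σ} → IsSimplex σ → IsSimplex (image ν σ)
    free       : ∀ {σ} → IsSimplex σ → Nonempty σ → ¬ image ν σ ≡ σ

∈-image : ∀ {n} (ν : Fin n → Fin n) σ {v} → ν v ∈ σ → v ∈ image ν σ
∈-image ν σ {v} νv∈σ =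
  lookup⇒[]= v _ (trans (lookup∘tabulate _ v) ([]=⇒lookup νv∈σ))

-- Barycentric coordinates supported on some simplex σ; equality of points of
-- the realization compares the coordinates only and ignores σ.
InRealization : (K : SimplicialComplex) → Pred (Fin (SimplicialComplex.vertices K) → ℝ) 0ℓ
InRealization K t =
  (∀ v → 0ℝ ≤ℝ t v) ×
  sum t ≈ℝ 1ℝ ×
  ∃ λ σ → IsSimplex σ × (∀ v → v ∉ σ → t v ≈ℝ 0ℝ)
  where open SimplicialComplex K

¬¬-decide : ∀ {n} {P : Pred (Fin n) 0ℓ} → ¬ ¬ (∀ v → Dec (P v))
¬¬-decide = sequence (RawMonad.rawApplicative ¬¬-Monad) (λ _ → ¬¬-excluded-middle)

-- As |K| lies in finitely many coordinates, its weak topology is the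
-- subspace topology.
∥_,_∥ : (K : SimplicialComplex) → FreeInvolution K → ℤ₂-Space
∥ K , τ ∥ = record
  { space = subspace (InRealization K)
  ; ν = record
    { func = record
      { to   = λ (t , 0≤t , Σt≈1 , σ , σ∈K , supp) →
          (λ v → t (ν v)) ,
          (λ v → 0≤t (ν v)) ,
          ≈ℝ-trans {sum (λ v → t (ν v))} {sum t} {1ℝ}
            (≈ℝ-sym {sum t} {sum (λ v → t (ν v))} (sum-permute t π)) Σt≈1 ,
          image ν σ , simplicial σ∈K , λ v v∉νσ → supp (ν v) (v∉νσ ∘ ∈-image ν σ)
      ; cong = λ s≈t v → s≈t (ν v)
      }
    ; continuous = λ V-open _ Vνs → case V-open _ Vνs of λ
        (ε , 0<ε , ball) → ε , 0<ε , λ _ near → ball _ (λ v → near (ν v))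
    }
  ; ν-involutive = λ (t , _) v →
      subst (λ w → t w ≈ℝ t v) (sym (involutive v)) (≈ℝ-refl {t v})
  ; ν-free = λ x νx≈x → ¬¬-decide (fixed-point x νx≈x)
  }
  where
  open SimplicialComplex K
  open FreeInvolution τ

  π : Permutation′ vertices
  π = permutation ν ν involutive involutive

  fixed-point : (x : Σ (Fin vertices → ℝ) (InRealization K)) →
                (∀ v → proj₁ x (ν v) ≈ℝ proj₁ x v) → ¬ (∀ v → Dec (proj₁ x v ≈ℝ 0ℝ))
  fixed-point (t , 0≤t , Σt≈1 , σ , σ∈K , supp) νt≈t zero? =
    free (downClosed S⊆σ σ∈K) S-nonempty νS≡S
    where
    S : Subset vertices
    S = tabulate (λ v → not (does (zero? v)))

    ∈S⇒≉0 : ∀ {v} → v ∈ S → ¬ t v ≈ℝ 0ℝ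
    ∈S⇒≉0 {v} v∈S tv≈0 with zero? v | trans (sym (lookup∘tabulate _ v)) ([]=⇒lookup v∈S)
    ... | yes _    | ()
    ... | no tv≉0  | _ = tv≉0 tv≈0

    ∉S⇒≈0 : ∀ {v} → v ∉ S → t v ≈ℝ 0ℝ
    ∉S⇒≈0 {v} v∉S with zero? v in eq
    ... | yes tv≈0 = tv≈0
    ... | no _     = contradiction
      (lookup⇒[]= v S (trans (lookup∘tabulate _ v) (cong (not ∘ does) eq))) v∉S

    S⊆σ : S ⊆ σ
    S⊆σ {v} v∈S with v ∈? σ
    ... | yes v∈σ = v∈σ
    ... | no v∉σ  = contradiction (supp v v∉σ) (∈S⇒≉0 v∈S)

    S-nonempty : Nonempty S
    S-nonempty with nonempty? S
    ... | yes S≢∅ = S≢∅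
    ... | no S≡∅  = contradiction
      (≈ℝ-trans {1ℝ} {sum t} {0ℝ} (≈ℝ-sym {sum t} {1ℝ} Σt≈1)
        (sum-zero (λ v → ∉S⇒≈0 (λ v∈S → S≡∅ (v , v∈S)))))
      1ℝ≉0ℝ

    same : ∀ v → not (does (zero? (ν v))) ≡ not (does (zero? v))
    same v with zero? (ν v) | zero? v
    ... | yes _ | yes _ = refl
    ... | no _  | no _  = refl
    ... | yes p | no ¬q =
      contradiction (≈ℝ-trans {t v} {t (ν v)} {0ℝ} (≈ℝ-sym {t (ν v)} {t v} (νt≈t v)) p) ¬q
    ... | no ¬p | yes q = contradiction (≈ℝ-trans {t (ν v)} {t v} {0ℝ} (νt≈t v) q) ¬p

    νS≡S : image ν S ≡ S
    νS≡S = tabulate-cong (λ v → trans (lookup∘tabulate _ (ν v)) (same v))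

record Graph : Set₁ where
  field
    order      : ℕ
    Adj        : Rel (Fin order) 0ℓ
    adj?       : Decidable Adj
    adj-sym    : Symmetric Adj
    adj-irrefl : Irreflexive _≡_ Adj

  Node : Set
  Node = Fin order

  Connected : Set
  Connected = ∀ u v → Star Adj u v

  ContainsK : ℕ → ℕ → Set
  ContainsK ℓ m = ∃ λ (f : Fin ℓ ⊎ Fin m → Node) →
    Injective _≡_ _≡_ f × (∀ i j → Adj (f (inj₁ i)) (f (inj₂ j)))

  CN : Subset order → Pred Node 0ℓ
  CN A v = ∀ {a} → a ∈ A → Adj a v

  IsNeighborhoodSimplex : Pred (Subset order) 0ℓ
  IsNeighborhoodSimplex A = Satisfiable (CN A)

  -- A ⊎ B is encoded as A ++ B: the nodes (v,0) and (v,1) are v ↑ˡ order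
  -- and order ↑ʳ v.
  IsBoxSimplex : Pred (Subset (order ℕ.+ order)) 0ℓ
  IsBoxSimplex σ = ∃₂ λ (A B : Subset order) →
    σ ≡ A ++ B ×
    IsNeighborhoodSimplex A ×
    IsNeighborhoodSimplex B ×
    (∀ {v} → v ∈ A → CN B v) ×
    (∀ {v} → v ∈ B → CN A v)

  ∈-++ˡ : ∀ (A B : Subset order) {v} → v ∈ A → v ↑ˡ order ∈ A ++ B
  ∈-++ˡ A B {v} v∈A = lookup⇒[]= _ _ (trans (lookup-++ˡ A B v) ([]=⇒lookup v∈A))

  ∈-++ʳ : ∀ (A B : Subset order) {v} → v ∈ B → order ↑ʳ v ∈ A ++ B
  ∈-++ʳ A B {v} v∈B = lookup⇒[]= _ _ (trans (lookup-++ʳ A B v) ([]=⇒lookup v∈B))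

  ++-⊆ˡ : ∀ (A B C D : Subset order) → A ++ B ⊆ C ++ D → A ⊆ C
  ++-⊆ˡ A B C D sub {v} v∈A = lookup⇒[]= v C
    (trans (sym (lookup-++ˡ C D v)) ([]=⇒lookup (sub (∈-++ˡ A B v∈A))))

  ++-⊆ʳ : ∀ (A B C D : Subset order) → A ++ B ⊆ C ++ D → B ⊆ D
  ++-⊆ʳ A B C D sub {v} v∈B = lookup⇒[]= v D
    (trans (sym (lookup-++ʳ C D v)) ([]=⇒lookup (sub (∈-++ʳ A B v∈B))))

  box : SimplicialComplex
  box = record
    { vertices   = order ℕ.+ order
    ; IsSimplex  = IsBoxSimplex
    ; downClosed = downClosed
    }
    where
    downClosed : ∀ {σ τ} → τ ⊆ σ → IsBoxSimplex σ → IsBoxSimplex τ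
    downClosed {τ = τ} τ⊆σ (A , B , refl , (v , v∈CN) , (w , w∈CN) , A⊆CNB , B⊆CNA) =
      C , D , sym C++D≡τ ,
      (v , λ a∈C → v∈CN (C⊆A a∈C)) , (w , λ b∈D → w∈CN (D⊆B b∈D)) ,
      (λ v∈C b∈D → A⊆CNB (C⊆A v∈C) (D⊆B b∈D)) , (λ v∈D a∈C → B⊆CNA (D⊆B v∈D) (C⊆A a∈C))
      where
      C D : Subset order
      C = take order τ
      D = drop order τ
      C++D≡τ : C ++ D ≡ τ
      C++D≡τ = take++drop≡id order τ
      C++D⊆A++B : C ++ D ⊆ A ++ B
      C++D⊆A++B = subst (_⊆ A ++ B) (sym C++D≡τ) τ⊆σ
      C⊆A : C ⊆ A
      C⊆A = ++-⊆ˡ C D A B C++D⊆A++B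
      D⊆B : D ⊆ B
      D⊆B = ++-⊆ʳ C D A B C++D⊆A++B

  swapCopies : Fin (order ℕ.+ order) → Fin (order ℕ.+ order)
  swapCopies v = join order order (Sum.swap (splitAt order v))

  image-swapCopies : ∀ A B → image swapCopies (A ++ B) ≡ B ++ A
  image-swapCopies A B = trans (tabulate-cong same) (tabulate∘lookup (B ++ A))
    where
    choose : ∀ s → [ lookup A , lookup B ]′ (Sum.swap s) ≡ [ lookup B , lookup A ]′ s
    choose (inj₁ _) = refl
    choose (inj₂ _) = refl
    same : ∀ v → lookup (A ++ B) (swapCopies v) ≡ lookup (B ++ A) v
    same v =
      trans (lookup-splitAt order A B (swapCopies v))
        (trans (cong [ lookup A , lookup B ]′ (splitAt-join order order (Sum.swap (splitAt order v))))
          (trans (choose (splitAt order v)) (sym (lookup-splitAt order B A v))))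

  box-involution : FreeInvolution box
  box-involution = record
    { ν          = swapCopies
    ; involutive = λ v → trans
        (cong (join order order ∘ Sum.swap) (splitAt-join order order (Sum.swap (splitAt order v))))
        (trans (cong (join order order) (swap-involutive (splitAt order v)))
               (join-splitAt order order v))
    ; simplicial = λ { (A , B , refl , A∈N , B∈N , A⊆CNB , B⊆CNA) →
        B , A , image-swapCopies A B , B∈N , A∈N , B⊆CNA , A⊆CNB }
    ; free       = λ { (A , B , refl , _ , _ , A⊆CNB , _) → free A B A⊆CNB }
    }
    where
    free : ∀ A B → (∀ {v} → v ∈ A → CN B v) → Nonempty (A ++ B) →
           ¬ image swapCopies (A ++ B) ≡ A ++ B
    free A B A⊆CNB (v , v∈A++B) eq =
      no-member v (trans (sym (lookup-splitAt order A B v)) ([]=⇒lookup v∈A++B))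
      where
      B++A≡A++B : B ++ A ≡ A ++ B
      B++A≡A++B = trans (sym (image-swapCopies A B)) eq
      B≡A : B ≡ A
      B≡A = ++-injectiveˡ B A B++A≡A++B
      absurd : ∀ {w} → ¬ w ∈ A
      absurd {w} w∈A = adj-irrefl refl (A⊆CNB w∈A (subst (w ∈_) (sym B≡A) w∈A))
      no-member : ∀ v → ¬ [ lookup A , lookup B ]′ (splitAt order v) ≡ inside
      no-member v with splitAt order v
      ... | inj₁ w = λ eq → absurd (lookup⇒[]= w A eq)
      ... | inj₂ w = λ eq → absurd (subst (w ∈_) B≡A (lookup⇒[]= w B eq))

  boxSpace : ℤ₂-Space
  boxSpace = ∥ box , box-involution ∥

{-# OPTIONS --safe #-}

-- Let t, x be the coordinates of a point of the box complex on the two copies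
-- of the node set, with maxima a and b.  The functions
--   y v = (b − a) + 2 (t v − max {x w : w not adjacent to v})
--   z v = (a − b) + 2 (x v − max {t w : w not adjacent to v})
-- have the same maximum a + b, and y v + z w ≤ 0 if v, w are not adjacent.
-- Hence for 0 ≤ c < a + b the level sets A = {y > c} and B = {z > c} form a
-- biclique.  Its pair of common neighbourhoods (CN A, CN B) shrinks as c
-- decreases, and excluding K_{ℓ,m} leaves it at most k = ℓ + m − 2 values: there
-- is a function rank A B < k, symmetric in A and B, that is strictly monotone
-- on them.  As A, B are nonempty and CN A ≠ CN B, a lexicographic comparison
-- yields a sign that changes when A and B are exchanged.  The j-th coordinate
-- of the map to ℝᵏ is the signed total length of the intervals of c on which
-- the rank is j.  It is odd, and no two terms cancel: for the given point,
-- bicliques of equal rank have equal signs.  So the map has no zero.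
--
-- Constructively, the coordinates are Lipschitz functions of rational
-- approximations, on which nonvanishing is established with a uniform bound.

module Submission where

open import Defs
open import Data.Nat.Base using (ℕ; _≥_)
open import Relation.Nullary using (¬_)

-- Common neighbourhoods, bicliques and their rank

module Bicliques (G : Graph) where
  open import Data.Empty using (⊥)
  open import Data.Fin.Base using (Fin; zero; suc)
  open import Data.Fin.Properties using (all?; suc-injective)
  open import Data.Fin.Subset using (Subset; inside; outside; _∈_; _⊆_; Nonempty; ∣_∣)
  open import Data.Fin.Subset.Properties
  open import Data.Nat.Base
  open import Data.Nat.Properties hiding (suc-injective)
  open import Data.Product.Base using (_×_; _,_; proj₁; proj₂)
  open import Data.Sum.Base using (_⊎_; inj₁; inj₂)
  open import Data.Vec.Base using ([]; _∷_; tabulate; here; there)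
  open import Data.Vec.Properties using (lookup⇒[]=; []=⇒lookup; lookup∘tabulate)
  open import Function.Base using (_∘_)
  open import Level using (0ℓ)
  open import Relation.Binary.PropositionalEquality
  open import Relation.Nullary
  open import Relation.Nullary.Decidable using (dec-true)
  open import Relation.Unary using (Pred; Decidable)

  open Graph G

  select : ∀ {n} {P : Pred (Fin n) 0ℓ} → Decidable P → Subset n
  select P? = tabulate (does ∘ P?)

  ∈-select⁺ : ∀ {n} {P : Pred (Fin n) 0ℓ} (P? : Decidable P) {v} → P v → v ∈ select P?
  ∈-select⁺ P? {v} Pv = lookup⇒[]= v _ (trans (lookup∘tabulate _ v) (dec-true (P? v) Pv))

  ∈-select⁻ : ∀ {n} {P : Pred (Fin n) 0ℓ} (P? : Decidable P) {v} → v ∈ select P? → P v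
  ∈-select⁻ P? {v} v∈ with P? v | trans (sym (lookup∘tabulate (does ∘ P?) v)) ([]=⇒lookup v∈)
  ... | yes Pv | _ = Pv
  ... | no _   | ()

  ⊆∧∣≥∣⇒⊇ : ∀ {n} {p q : Subset n} → p ⊆ q → ∣ q ∣ ≤ ∣ p ∣ → q ⊆ p
  ⊆∧∣≥∣⇒⊇ {p = p} {q} p⊆q ∣q∣≤∣p∣ {v} v∈q with v ∈? p
  ... | yes v∈p = v∈p
  ... | no v∉p  = contradiction (p⊂q⇒∣p∣<∣q∣ (p⊆q , v , v∈q , v∉p)) (≤⇒≯ ∣q∣≤∣p∣)

  nonempty⇒∣∣≥1 : ∀ {n} {p : Subset n} → Nonempty p → 1 ≤ ∣ p ∣
  nonempty⇒∣∣≥1 {p = inside ∷ p}  _ = s≤s z≤n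
  nonempty⇒∣∣≥1 {p = outside ∷ p} (suc v , there v∈p) = nonempty⇒∣∣≥1 (v , v∈p)

  element : ∀ {n} (p : Subset n) {i} → i ≤ ∣ p ∣ → Fin i → Fin n
  element []            z≤n ()
  element (inside ∷ p)  i≤ zero    = zero
  element (inside ∷ p)  i≤ (suc j) = suc (element p (s≤s⁻¹ i≤) j)
  element (outside ∷ p) i≤ j       = suc (element p i≤ j)

  element-∈ : ∀ {n} (p : Subset n) {i} (i≤ : i ≤ ∣ p ∣) j → element p i≤ j ∈ p
  element-∈ []            z≤n ()
  element-∈ (inside ∷ p)  i≤ zero    = here
  element-∈ (inside ∷ p)  i≤ (suc j) = there (element-∈ p (s≤s⁻¹ i≤) j)
  element-∈ (outside ∷ p) i≤ j       = there (element-∈ p i≤ j)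

  element-injective : ∀ {n} (p : Subset n) {i} (i≤ : i ≤ ∣ p ∣) {j k} →
                      element p i≤ j ≡ element p i≤ k → j ≡ k
  element-injective []            z≤n {()}
  element-injective (inside ∷ p)  i≤ {zero}  {zero}  _  = refl
  element-injective (inside ∷ p)  i≤ {suc j} {suc k} eq =
    cong suc (element-injective p (s≤s⁻¹ i≤) (suc-injective eq))
  element-injective (outside ∷ p) i≤ eq = element-injective p i≤ (suc-injective eq)

  CN? : ∀ A → Decidable (λ v → ∀ a → a ∈ A → Adj a v)
  CN? A v = all? (λ a → (a ∈? A) →-dec adj? a v)

  cn : Subset order → Subset order
  cn A = select (CN? A)

  ∈-cn⁺ : ∀ {A v} → CN A v → v ∈ cn A
  ∈-cn⁺ {A} A~v = ∈-select⁺ (CN? A) (λ _ → A~v)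

  ∈-cn⁻ : ∀ {A v} → v ∈ cn A → CN A v
  ∈-cn⁻ {A} v∈ = ∈-select⁻ (CN? A) v∈ _

  cn-antitone : ∀ {A B} → A ⊆ B → cn B ⊆ cn A
  cn-antitone A⊆B v∈ = ∈-cn⁺ (λ a∈A → ∈-cn⁻ v∈ (A⊆B a∈A))

  ⊆cn-sym : ∀ {A B} → A ⊆ cn B → B ⊆ cn A
  ⊆cn-sym A⊆cnB b∈B = ∈-cn⁺ (λ a∈A → adj-sym (∈-cn⁻ (A⊆cnB a∈A) b∈B))

  ⊆cn∘cn : ∀ {A} → A ⊆ cn (cn A)
  ⊆cn∘cn = ⊆cn-sym ⊆-refl

  -- The closed sets of the Galois connection of `cn` with itself. On them `cn` is injective, which
  -- lets `height-strict` recover `P` from `cn P`.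
  Closed : Pred (Subset order) 0ℓ
  Closed P = cn (cn P) ≡ P

  cn-closed : ∀ A → Closed (cn A)
  cn-closed A = ⊆-antisym (cn-antitone ⊆cn∘cn) ⊆cn∘cn

  -- Phrased with cardinalities instead of injections, so that sets such as `P` and `cn P` can be
  -- inserted directly. Disjointness of `X` and `Y` follows from `X ⊆ cn Y`, as adjacency is
  -- irreflexive.
  BicliqueFree : ℕ → ℕ → Set
  BicliqueFree p q = ∀ X Y → X ⊆ cn Y → p ≤ ∣ X ∣ → q ≤ ∣ Y ∣ → ⊥

  bicliqueFree-sym : ∀ {p q} → BicliqueFree p q → BicliqueFree q p
  bicliqueFree-sym free X Y X⊆cnY q≤∣X∣ p≤∣Y∣ = free Y X (⊆cn-sym X⊆cnY) p≤∣Y∣ q≤∣X∣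

  ¬ContainsK⇒bicliqueFree : ∀ {p q} → ¬ ContainsK p q → BicliqueFree p q
  ¬ContainsK⇒bicliqueFree {p} {q} ¬K X Y X⊆cnY p≤∣X∣ q≤∣Y∣ = ¬K (f , f-injective , f-adj)
    where
    f : Fin p ⊎ Fin q → Node
    f (inj₁ i) = element X p≤∣X∣ i
    f (inj₂ j) = element Y q≤∣Y∣ j

    f-adj : ∀ i j → Adj (f (inj₁ i)) (f (inj₂ j))
    f-adj i j = adj-sym (∈-cn⁻ (X⊆cnY (element-∈ X p≤∣X∣ i)) (element-∈ Y q≤∣Y∣ j))

    f-injective : ∀ {x y} → f x ≡ f y → x ≡ y
    f-injective {inj₁ _} {inj₁ _} eq = cong inj₁ (element-injective X p≤∣X∣ eq)
    f-injective {inj₂ _} {inj₂ _} eq = cong inj₂ (element-injective Y q≤∣Y∣ eq)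
    -- A node in both parts would be adjacent to itself.
    f-injective {inj₁ i} {inj₂ j} eq = contradiction (f-adj i j) (adj-irrefl eq)
    f-injective {inj₂ i} {inj₁ j} eq = contradiction (f-adj j i) (adj-irrefl (sym eq))

  -- Grows along chains of closed sets A = cn P: it counts A up while ∣ A ∣ < p,
  -- and then counts P = cn A, which has fewer than q nodes, down.
  height : ℕ → ℕ → Subset order → ℕ
  height p q P with ∣ cn P ∣ <? p
  ... | yes _ = ∣ cn P ∣
  ... | no _  = (p + q ∸ 1) ∸ ∣ P ∣

  module _ {p q : ℕ} (free : BicliqueFree p q) (p≥1 : 1 ≤ p) (q≥1 : 1 ≤ q) where
    private
      c : ℕ
      c = p + q ∸ 1

      -- `cn P` and `P` form a biclique, so `p ≤ ∣ cn P ∣` forces `∣ P ∣ < q`. Hence the second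
      -- branch of `height` only takes values of at least `p`, above all values of the first.
      large⇒small : ∀ {P} → ¬ ∣ cn P ∣ < p → p ≤ c ∸ ∣ P ∣
      large⇒small {P} ≮ = m+n≤o⇒m≤o∸n p (begin
        p + ∣ P ∣   ≤⟨ +-monoʳ-≤ p (∸-monoˡ-≤ 1 ∣P∣<q) ⟩
        p + (q ∸ 1) ≡⟨ +-∸-assoc p q≥1 ⟨
        c           ∎)
        where
        open ≤-Reasoning
        ∣P∣<q : ∣ P ∣ < q
        ∣P∣<q = ≰⇒> (λ q≤∣P∣ → free (cn P) P ⊆-refl (≮⇒≥ ≮) q≤∣P∣)

    height-≥1 : ∀ {P} → Nonempty (cn P) → 1 ≤ height p q P
    height-≥1 {P} P≢∅ with ∣ cn P ∣ <? p
    ... | yes _ = nonempty⇒∣∣≥1 P≢∅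
    ... | no ≮  = ≤-trans p≥1 (large⇒small {P} ≮)

    -- When `P` shrinks, `cn P` grows. So the branch can change only from the first to the second,
    -- where `large⇒small` puts the value higher.
    height-mono : ∀ {P P*} → P* ⊆ P → height p q P ≤ height p q P*
    height-mono {P} {P*} P*⊆P with ∣ cn P ∣ <? p | ∣ cn P* ∣ <? p
    ... | yes _ | yes _ = p⊆q⇒∣p∣≤∣q∣ (cn-antitone P*⊆P)
    ... | yes < | no ≮  = ≤-trans (<⇒≤ <) (large⇒small {P*} ≮)
    ... | no ≮  | yes < = contradiction (≤-<-trans (p⊆q⇒∣p∣≤∣q∣ (cn-antitone P*⊆P)) <) ≮
    ... | no _  | no _  = ∸-monoʳ-≤ c (p⊆q⇒∣p∣≤∣q∣ P*⊆P)

    -- The height cannot stay put across branches. In the first branch `cn P` and `cn P*` are nested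
    -- of equal size, and closedness carries their equality over to `P` and `P*`; in the second
    -- branch `P` and `P*` themselves are nested of equal size.
    height-strict : ∀ {P P*} → Closed P → Closed P* → P* ⊆ P →
                    height p q P* ≤ height p q P → P ≡ P*
    height-strict {P} {P*} P-closed P*-closed P*⊆P h*≤h with ∣ cn P ∣ <? p | ∣ cn P* ∣ <? p
    ... | yes _ | yes _ =
      trans (sym P-closed) (trans (cong cn (⊆-antisym cnP⊆cnP* (⊆∧∣≥∣⇒⊇ cnP⊆cnP* h*≤h))) P*-closed)
      where
      cnP⊆cnP* : cn P ⊆ cn P*
      cnP⊆cnP* = cn-antitone P*⊆P
    ... | yes < | no ≮  = contradiction (≤-<-trans (≤-trans (large⇒small {P*} ≮) h*≤h) <) (<-irrefl refl)
    ... | no ≮  | yes < = contradiction (≤-<-trans (p⊆q⇒∣p∣≤∣q∣ (cn-antitone P*⊆P)) <) ≮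
    ... | no ≮  | no _  = ⊆-antisym (⊆∧∣≥∣⇒⊇ P*⊆P (∸-cancelʳ-≤ ∣P∣≤c h*≤h)) P*⊆P
      where
      ∣P∣≤c : ∣ P ∣ ≤ c
      -- By `large⇒small` the truncated difference is at least `p`, hence positive, hence exact; so
      -- it can be cancelled.
      ∣P∣≤c = <⇒≤ (m∸n≢0⇒n<m (λ eq → <⇒≢ (≤-trans p≥1 (large⇒small {P} ≮)) (sym eq)))

    -- If just one of the two sets is in the second branch, the size subtracted there absorbs the
    -- other summand, as `∣ cn P ∣ ≤ ∣ Q ∣` and `∣ cn Q ∣ ≤ ∣ P ∣`. If both were, `Q` and `cn Q`
    -- would form a forbidden biclique.
    height-bound : ∀ {P Q} → cn P ⊆ Q → cn Q ⊆ P →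
                   height p q P + height q p Q ≤ c
    height-bound {P} {Q} cnP⊆Q cnQ⊆P with ∣ cn P ∣ <? p | ∣ cn Q ∣ <? q
    ... | yes <p | yes <q = begin
      ∣ cn P ∣ + ∣ cn Q ∣   ≤⟨ +-mono-≤ (<⇒≤ <p) (∸-monoˡ-≤ 1 <q) ⟩
      p + (q ∸ 1)           ≡⟨ +-∸-assoc p q≥1 ⟨
      c                     ∎
      where open ≤-Reasoning
    ... | yes <p | no ≮q = begin
      ∣ cn P ∣ + (q + p ∸ 1 ∸ ∣ Q ∣) ≡⟨ cong (λ s → ∣ cn P ∣ + (s ∸ 1 ∸ ∣ Q ∣)) (+-comm q p) ⟩
      ∣ cn P ∣ + (c ∸ ∣ Q ∣)         ≤⟨ +-monoˡ-≤ _ (p⊆q⇒∣p∣≤∣q∣ cnP⊆Q) ⟩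
      ∣ Q ∣ + (c ∸ ∣ Q ∣)            ≡⟨ m+[n∸m]≡n ∣Q∣≤c ⟩
      c                              ∎
      where
      open ≤-Reasoning
      ∣Q∣≤c : ∣ Q ∣ ≤ c
      ∣Q∣≤c = ≤-trans (<⇒≤ (≰⇒> (λ p≤∣Q∣ → free Q (cn Q) ⊆cn∘cn p≤∣Q∣ (≮⇒≥ ≮q))))
                (subst (p ≤_) (sym (+-∸-assoc p q≥1)) (m≤m+n p (q ∸ 1)))
    ... | no ≮p | yes <q = begin
      (c ∸ ∣ P ∣) + ∣ cn Q ∣ ≤⟨ +-monoʳ-≤ (c ∸ ∣ P ∣) (p⊆q⇒∣p∣≤∣q∣ cnQ⊆P) ⟩
      (c ∸ ∣ P ∣) + ∣ P ∣    ≡⟨ m∸n+n≡m ∣P∣≤c ⟩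
      c                      ∎
      where
      open ≤-Reasoning
      ∣P∣≤c : ∣ P ∣ ≤ c
      ∣P∣≤c = <⇒≤ (m∸n≢0⇒n<m (λ eq → <⇒≢ (≤-trans p≥1 (large⇒small {P} ≮p)) (sym eq)))
    ... | no ≮p | no ≮q = contradiction (≮⇒≥ ≮q)
      (free Q (cn Q) ⊆cn∘cn (≤-trans (≮⇒≥ ≮p) (p⊆q⇒∣p∣≤∣q∣ cnP⊆Q)))

  record Biclique (A B : Subset order) : Set where
    constructor biclique
    field
      nonemptyˡ : Nonempty A
      nonemptyʳ : Nonempty B
      adjacent  : A ⊆ cn B

  biclique-sym : ∀ {A B} → Biclique A B → Biclique B A
  biclique-sym (biclique A≢∅ B≢∅ A⊆cnB) = biclique B≢∅ A≢∅ (⊆cn-sym A⊆cnB)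

  biclique? : ∀ A B → Dec (Biclique A B)
  biclique? A B with nonempty? A | nonempty? B | A ⊆? cn B
  ... | yes A≢∅ | yes B≢∅ | yes A⊆cnB = yes (biclique A≢∅ B≢∅ A⊆cnB)
  ... | no A≡∅  | _       | _         = no (A≡∅ ∘ Biclique.nonemptyˡ)
  ... | _       | no B≡∅  | _         = no (B≡∅ ∘ Biclique.nonemptyʳ)
  ... | _       | _       | no A⊈cnB  = no (λ b → A⊈cnB (Biclique.adjacent b))

  -- A node of `A` lies in `cn B`; if it also lay in `cn A`, it would be adjacent to itself.
  biclique⇒cn≢ : ∀ {A B} → Biclique A B → cn A ≢ cn B
  biclique⇒cn≢ (biclique (a , a∈A) _ A⊆cnB) cnA≡cnB =
    adj-irrefl refl (∈-cn⁻ (subst (a ∈_) (sym cnA≡cnB) (A⊆cnB a∈A)) a∈A)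

  +-squeeze : ∀ {x y x* y*} → x ≤ x* → y ≤ y* → x* + y* ≤ x + y → x* ≤ x × y* ≤ y
  +-squeeze {x} {y} {x*} {y*} x≤x* y≤y* sum≤ =
    +-cancelʳ-≤ y* x* x (≤-trans sum≤ (+-monoʳ-≤ x y≤y*)) ,
    +-cancelˡ-≤ x* y* y (≤-trans sum≤ (+-monoˡ-≤ y x≤x*))

  ⊔-squeeze : ∀ {x y x* y*} → x* ⊔ y* ≤ x ⊔ y → x* ≤ x ⊎ y* ≤ y
  ⊔-squeeze {x} {y} {x*} {y*} max≤ with ⊔-sel x y
  ... | inj₁ eq = inj₁ (≤-trans (m≤m⊔n x* y*) (subst (x* ⊔ y* ≤_) eq max≤))
  ... | inj₂ eq = inj₂ (≤-trans (m≤n⊔m x* y*) (subst (x* ⊔ y* ≤_) eq max≤))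

  module Rank (p q : ℕ) where

    -- The parameters are exchanged in the second summand, as `height-bound` requires.
    heights : Subset order → Subset order → ℕ
    heights A B = height p q (cn A) + height q p (cn B)

    -- The maximum makes the rank invariant under exchanging A and B.
    rank : Subset order → Subset order → ℕ
    rank A B = (heights A B ⊔ heights B A) ∸ 2

    rank-sym : ∀ A B → rank A B ≡ rank B A
    rank-sym A B = cong (_∸ 2) (⊔-comm (heights A B) (heights B A))

    module _ (free : BicliqueFree p q) (p≥1 : 1 ≤ p) (q≥1 : 1 ≤ q) where
      private
        free′ : BicliqueFree q p
        free′ = bicliqueFree-sym free

      heights-≥2 : ∀ {A B} → Biclique A B → 2 ≤ heights A B
      heights-≥2 {A} {B} (biclique (a , a∈A) (b , b∈B) _) = +-mono-≤
        (height-≥1 free p≥1 q≥1 {cn A} (a , ⊆cn∘cn a∈A))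
        (height-≥1 free′ q≥1 p≥1 {cn B} (b , ⊆cn∘cn b∈B))

      heights-bound : ∀ {A B} → Biclique A B → heights A B ≤ p + q ∸ 1
      heights-bound (biclique _ _ A⊆cnB) = height-bound free p≥1 q≥1
        (cn-antitone (⊆cn-sym A⊆cnB))
        (cn-antitone A⊆cnB)

      -- On bicliques `heights` ranges from 2 to `p + q ∸ 1`. This explains the shift by 2 in `rank`
      -- and leaves `p + q ∸ 2` values.
      rank-bound : ∀ {A B} → Biclique A B → rank A B < p + q ∸ 2
      rank-bound {A} {B} b = begin-strict
        (heights A B ⊔ heights B A) ∸ 2 <⟨ ∸-monoˡ-< (n<1+n _) (≤-trans (heights-≥2 b) (m≤m⊔n _ _)) ⟩
        suc (heights A B ⊔ heights B A) ∸ 2 ≤⟨ ∸-monoˡ-≤ 2 (s≤s (⊔-lub (heights-bound b) heights-bound′)) ⟩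
        suc (p + q ∸ 1) ∸ 2                 ≡⟨⟩
        p + q ∸ 1 ∸ 1                       ≡⟨ ∸-+-assoc (p + q) 1 1 ⟩
        p + q ∸ 2                           ∎
        where
        open ≤-Reasoning
        heights-bound′ : heights B A ≤ p + q ∸ 1
        heights-bound′ = heights-bound (biclique-sym b)

      -- If the maxima agree, then `heights A B` or `heights B A` does not grow. Its two summands
      -- are monotone, so neither of them grows, and `height-strict` applies to the closed sets
      -- `cn A` and `cn B`.
      rank-strict : ∀ {A B A* B*} → Biclique A B → Biclique A* B* → A ⊆ A* → B ⊆ B* →
                    rank A B ≡ rank A* B* → cn A ≡ cn A* × cn B ≡ cn B*
      rank-strict {A} {B} {A*} {B*} b b* A⊆A* B⊆B* rank≡ =
        conclude (⊔-squeeze {heights A B} {heights B A} {heights A* B*} (≤-reflexive (sym max≡)))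
        where
        max≡ : heights A B ⊔ heights B A ≡ heights A* B* ⊔ heights B* A*
        max≡ = ∸-cancelʳ-≡ (≤-trans (heights-≥2 b) (m≤m⊔n _ _))
                 (≤-trans (heights-≥2 b*) (m≤m⊔n _ _)) rank≡

        heights-strict : ∀ {A B A* B*} → A ⊆ A* → B ⊆ B* → heights A* B* ≤ heights A B →
                         cn A ≡ cn A* × cn B ≡ cn B*
        heights-strict {A} {B} {A*} {B*} A⊆A* B⊆B* h*≤h =
          height-strict free p≥1 q≥1 (cn-closed A) (cn-closed A*) cnA*⊆cnA (proj₁ squeezed) ,
          height-strict free′ q≥1 p≥1 (cn-closed B) (cn-closed B*) cnB*⊆cnB (proj₂ squeezed)
          where
          cnA*⊆cnA : cn A* ⊆ cn A
          cnA*⊆cnA = cn-antitone A⊆A*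
          cnB*⊆cnB : cn B* ⊆ cn B
          cnB*⊆cnB = cn-antitone B⊆B*
          squeezed : height p q (cn A*) ≤ height p q (cn A) × height q p (cn B*) ≤ height q p (cn B)
          squeezed = +-squeeze (height-mono free p≥1 q≥1 cnA*⊆cnA)
                       (height-mono free′ q≥1 p≥1 cnB*⊆cnB) h*≤h

        conclude : heights A* B* ≤ heights A B ⊎ heights B* A* ≤ heights B A →
                   cn A ≡ cn A* × cn B ≡ cn B*
        conclude (inj₁ h*≤h) = heights-strict A⊆A* B⊆B* h*≤h
        conclude (inj₂ h*≤h) =
          let cnB≡ , cnA≡ = heights-strict B⊆B* A⊆A* h*≤h in cnA≡ , cnB≡

-- Functions uniformly continuous on boxes of rational vectors

module TameFunctions where
  open import Data.Fin.Base using (Fin)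
  open import Data.Nat.Base using (ℕ)
  open import Data.Product.Base using (∃; _×_; _,_; proj₁; proj₂)
  open import Data.Rational.Base as ℚ
    using (ℚ; 0ℚ; 1ℚ; _+_; _*_; -_; _-_; ∣_∣; _<_; _≤_; _⊔_; _⊓_)
  import Data.Rational.Properties as ℚ
  open import Data.Rational.Solver using (module +-*-Solver)
  open import Data.Sum.Base using (inj₁; inj₂)
  open import Level using (0ℓ)
  open import Relation.Binary.PropositionalEquality
  open import Relation.Unary using (Pred)

  p≤∣p∣ : ∀ p → p ≤ ∣ p ∣
  p≤∣p∣ p with ℚ.≤-total 0ℚ p
  ... | inj₁ 0≤p = ℚ.≤-reflexive (sym (ℚ.0≤p⇒∣p∣≡p 0≤p))
  ... | inj₂ p≤0 = ℚ.≤-trans p≤0 (ℚ.0≤∣p∣ p)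

  ∣∣-< : ∀ {p ε} → p < ε → - p < ε → ∣ p ∣ < ε
  ∣∣-< {p} p<ε -p<ε with ℚ.∣p∣≡p∨∣p∣≡-p p
  ... | inj₁ eq = subst (_< _) (sym eq) p<ε
  ... | inj₂ eq = subst (_< _) (sym eq) -p<ε

  -[p-q]≡q-p : ∀ p q → - (p - q) ≡ q - p
  -[p-q]≡q-p = solve 2 (λ p q → :- (p :- q) := q :- p) refl
    where open +-*-Solver

  -‿monoʳ-≤ : ∀ p {q r} → q ≤ r → p - r ≤ p - q
  -‿monoʳ-≤ p q≤r = ℚ.+-monoʳ-≤ p (ℚ.neg-antimono-≤ q≤r)

  ⊔-diff : ∀ p q r s {ε} → p - r < ε → q - s < ε → (p ⊔ q) - (r ⊔ s) < ε
  ⊔-diff p q r s p-r<ε q-s<ε with ℚ.⊔-sel p q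
  ... | inj₁ eq rewrite eq = ℚ.≤-<-trans (-‿monoʳ-≤ p (ℚ.p≤p⊔q r s)) p-r<ε
  ... | inj₂ eq rewrite eq = ℚ.≤-<-trans (-‿monoʳ-≤ q (ℚ.p≤q⊔p r s)) q-s<ε

  ⊓-diff : ∀ p q r s {ε} → p - r < ε → q - s < ε → (p ⊓ q) - (r ⊓ s) < ε
  ⊓-diff p q r s p-r<ε q-s<ε with ℚ.⊓-sel r s
  ... | inj₁ eq rewrite eq = ℚ.≤-<-trans (ℚ.+-monoˡ-≤ (- r) (ℚ.p⊓q≤p p q)) p-r<ε
  ... | inj₂ eq rewrite eq = ℚ.≤-<-trans (ℚ.+-monoˡ-≤ (- s) (ℚ.p⊓q≤q p q)) q-s<ε

  -- One-sided estimates suffice: exchanging the two pairs in `diff` bounds the negative of the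
  -- difference.
  lift-diff : (_∙_ : ℚ → ℚ → ℚ) →
              (∀ p q r s {ε} → p - r < ε → q - s < ε → (p ∙ q) - (r ∙ s) < ε) →
              ∀ p q r s {ε} → ∣ p - r ∣ < ε → ∣ q - s ∣ < ε → ∣ (p ∙ q) - (r ∙ s) ∣ < ε
  lift-diff _∙_ diff p q r s {ε} p≈r q≈s = ∣∣-<
    (diff p q r s (ℚ.≤-<-trans (p≤∣p∣ _) p≈r) (ℚ.≤-<-trans (p≤∣p∣ _) q≈s))
    (subst (_< ε) (sym (-[p-q]≡q-p (p ∙ q) (r ∙ s)))
      (diff r s p q (ℚ.≤-<-trans (p≤∣p∣ _) (subst (_< ε) (dist-sym p r) p≈r))
            (ℚ.≤-<-trans (p≤∣p∣ _) (subst (_< ε) (dist-sym q s) q≈s))))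

  ∣∣-⊔-< : ∀ {p q A B} → ∣ p ∣ < A → ∣ q ∣ < B → ∣ p ⊔ q ∣ < A ⊔ B
  ∣∣-⊔-< {p} {q} {A} {B} p<A q<B with ℚ.⊔-sel p q
  ... | inj₁ eq rewrite eq = ℚ.<-≤-trans p<A (ℚ.p≤p⊔q A B)
  ... | inj₂ eq rewrite eq = ℚ.<-≤-trans q<B (ℚ.p≤q⊔p A B)

  ∣∣-⊓-< : ∀ {p q A B} → ∣ p ∣ < A → ∣ q ∣ < B → ∣ p ⊓ q ∣ < A ⊔ B
  ∣∣-⊓-< {p} {q} {A} {B} p<A q<B with ℚ.⊓-sel p q
  ... | inj₁ eq rewrite eq = ℚ.<-≤-trans p<A (ℚ.p≤p⊔q A B)
  ... | inj₂ eq rewrite eq = ℚ.<-≤-trans q<B (ℚ.p≤q⊔p A B)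

  0<⊓ : ∀ {p q} → 0ℚ < p → 0ℚ < q → 0ℚ < p ⊓ q
  0<⊓ {p} {q} 0<p 0<q with ℚ.⊓-sel p q
  ... | inj₁ eq rewrite eq = 0<p
  ... | inj₂ eq rewrite eq = 0<q

  0<⊔ : ∀ {p} q → 0ℚ < p → 0ℚ < p ⊔ q
  0<⊔ {p} q 0<p = ℚ.<-≤-trans 0<p (ℚ.p≤p⊔q p q)

  Box : ∀ {n} → ℚ → Pred (Fin n → ℚ) 0ℓ
  Box B x = ∀ i → ∣ x i ∣ < B

  Close : ∀ {n} → ℚ → (x y : Fin n → ℚ) → Set
  Close δ x y = ∀ i → ∣ x i - y i ∣ < δ

  close-mono : ∀ {n δ ε} {x y : Fin n → ℚ} → δ ≤ ε → Close δ x y → Close ε x y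
  close-mono δ≤ε x≈y i = ℚ.<-≤-trans (x≈y i) δ≤ε

  -- Such functions on ℚⁿ act termwise on Cauchy sequences, hence on ℝⁿ.
  record Tame {n} (Φ : (Fin n → ℚ) → ℚ) : Set where
    field
      bound : ∀ B → ∃ λ C → 0ℚ < C × (∀ x → Box B x → ∣ Φ x ∣ < C)
      cont  : ∀ B ε → 0ℚ < ε →
              ∃ λ δ → 0ℚ < δ × (∀ x y → Box B x → Box B y → Close δ x y → ∣ Φ x - Φ y ∣ < ε)

  open Tame

  tame-const : ∀ {n} q → Tame {n} (λ _ → q)
  tame-const q .bound B = ∣ q ∣ + 1ℚ , 0<C , λ _ _ → ∣q∣<C
    where
    ∣q∣<C : ∣ q ∣ < ∣ q ∣ + 1ℚ
    ∣q∣<C = subst (_< ∣ q ∣ + 1ℚ) (ℚ.+-identityʳ ∣ q ∣) (ℚ.+-monoʳ-< ∣ q ∣ 0<1)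
    0<C : 0ℚ < ∣ q ∣ + 1ℚ
    0<C = ℚ.≤-<-trans (ℚ.0≤∣p∣ q) ∣q∣<C
  tame-const q .cont B ε 0<ε = 1ℚ , 0<1 , λ _ _ _ _ _ → subst (_< ε) (sym (dist-refl q)) 0<ε

  tame-coord : ∀ {n} (i : Fin n) → Tame (λ x → x i)
  -- `B` is arbitrary, but the bound has to be positive.
  tame-coord i .bound B = 1ℚ ⊔ B , 0<⊔ B 0<1 , λ x x∈B → ℚ.<-≤-trans (x∈B i) (ℚ.p≤q⊔p 1ℚ B)
  tame-coord i .cont B ε 0<ε = ε , 0<ε , λ _ _ _ _ x≈y → x≈y i

  module _ {n : ℕ} {Φ Ψ : (Fin n → ℚ) → ℚ} (Φ-tame : Tame Φ) (Ψ-tame : Tame Ψ) where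

    private
      combine-bound : (_∙_ _∘_ : ℚ → ℚ → ℚ) → (∀ {A B} → 0ℚ < A → 0ℚ < B → 0ℚ < A ∘ B) →
        (∀ {p q A B} → 0ℚ < A → ∣ p ∣ < A → ∣ q ∣ < B → ∣ p ∙ q ∣ < A ∘ B) →
        ∀ B → ∃ λ C → 0ℚ < C × (∀ x → Box B x → ∣ Φ x ∙ Ψ x ∣ < C)
      combine-bound _∙_ _∘_ pos combine B =
        let C , 0<C , ΦC = bound Φ-tame B
            D , 0<D , ΨD = bound Ψ-tame B
        in C ∘ D , pos 0<C 0<D , λ x x∈B → combine 0<C (ΦC x x∈B) (ΨD x x∈B)

      both-cont : ∀ B δ → 0ℚ < δ → ∃ λ η → 0ℚ < η × (∀ x y → Box B x → Box B y → Close η x y →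
                  ∣ Φ x - Φ y ∣ < δ × ∣ Ψ x - Ψ y ∣ < δ)
      both-cont B δ 0<δ =
        let η , 0<η , Φη = cont Φ-tame B δ 0<δ
            θ , 0<θ , Ψθ = cont Ψ-tame B δ 0<δ
        in η ⊓ θ , 0<⊓ 0<η 0<θ , λ x y x∈B y∈B x≈y →
             Φη x y x∈B y∈B (close-mono {x = x} {y} (ℚ.p⊓q≤p η θ) x≈y) ,
             Ψθ x y x∈B y∈B (close-mono {x = x} {y} (ℚ.p⊓q≤q η θ) x≈y)

    tame-+ : Tame (λ x → Φ x + Ψ x)
    tame-+ .bound = combine-bound _+_ _+_ (ℚ.+-mono-< {0ℚ} {_} {0ℚ})
      (λ {p} {q} _ p<A q<B → ℚ.≤-<-trans (ℚ.∣p+q∣≤∣p∣+∣q∣ p q) (ℚ.+-mono-< p<A q<B))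
    tame-+ .cont B ε 0<ε =
      let δ , 0<δ , δ+δ≡ε = halve 0<ε
          η , 0<η , close = both-cont B δ 0<δ
      in η , 0<η , λ x y x∈B y∈B x≈y → let Φ≈ , Ψ≈ = close x y x∈B y∈B x≈y in
           dist-+-< (Φ x) (Ψ x) (Φ y) (Ψ y) δ+δ≡ε Φ≈ Ψ≈

    tame-* : Tame (λ x → Φ x * Ψ x)
    tame-* .bound = combine-bound _*_ _*_
      (λ {A} {B} 0<A 0<B → subst (_< A * B) (ℚ.*-zeroʳ A)
        (ℚ.*-monoʳ-<-pos A {{ℚ.positive 0<A}} 0<B))
      (λ {p} {q} {A} {B} 0<A p<A q<B →
        subst (_< A * B) (sym (ℚ.∣p*q∣≡∣p∣*∣q∣ p q)) (*-bound 0<A {p} {q} p<A q<B))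
    tame-* .cont B ε 0<ε =
      let C , 0<C , ΦC    = bound Φ-tame B
          D , 0<D , ΨD    = bound Ψ-tame B
          δ , 0<δ , eq    = divide {C + D} {ε} (ℚ.+-mono-< {0ℚ} {C} {0ℚ} {D} 0<C 0<D) 0<ε
          η , 0<η , close = both-cont B δ 0<δ
      in η , 0<η , λ x y x∈B y∈B x≈y → let Φ≈ , Ψ≈ = close x y x∈B y∈B x≈y in
           ℚ.≤-<-trans (dist-* (Φ x) (Ψ x) (Φ y) (Ψ y))
             (subst (∣ Φ x ∣ * ∣ Ψ x - Ψ y ∣ + ∣ Ψ y ∣ * ∣ Φ x - Φ y ∣ <_)
               (trans (sym (ℚ.*-distribʳ-+ δ C D)) eq)
               (ℚ.+-mono-< (*-bound 0<C {Φ x} {Ψ x - Ψ y} (ΦC x x∈B) Ψ≈)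
                           (*-bound 0<D {Ψ y} {Φ x - Φ y} (ΨD y y∈B) Φ≈)))

    tame-⊔ : Tame (λ x → Φ x ⊔ Ψ x)
    tame-⊔ .bound = combine-bound _⊔_ _⊔_ (λ {A} {B} 0<A _ → 0<⊔ B 0<A) (λ _ → ∣∣-⊔-<)
    tame-⊔ .cont B ε 0<ε =
      let η , 0<η , close = both-cont B ε 0<ε
      in η , 0<η , λ x y x∈B y∈B x≈y → let Φ≈ , Ψ≈ = close x y x∈B y∈B x≈y in
           lift-diff _⊔_ ⊔-diff (Φ x) (Ψ x) (Φ y) (Ψ y) Φ≈ Ψ≈

    tame-⊓ : Tame (λ x → Φ x ⊓ Ψ x)
    tame-⊓ .bound = combine-bound _⊓_ _⊔_ (λ {A} {B} 0<A _ → 0<⊔ B 0<A) (λ _ → ∣∣-⊓-<)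
    tame-⊓ .cont B ε 0<ε =
      let η , 0<η , close = both-cont B ε 0<ε
      in η , 0<η , λ x y x∈B y∈B x≈y → let Φ≈ , Ψ≈ = close x y x∈B y∈B x≈y in
           lift-diff _⊓_ ⊓-diff (Φ x) (Ψ x) (Φ y) (Ψ y) Φ≈ Ψ≈

  module _ {n : ℕ} {Φ : (Fin n → ℚ) → ℚ} (Φ-tame : Tame Φ) where

    tame-neg : Tame (λ x → - Φ x)
    tame-neg .bound B =
      let C , 0<C , ΦC = bound Φ-tame B
      in C , 0<C , λ x x∈B → subst (_< C) (sym (ℚ.∣-p∣≡∣p∣ (Φ x))) (ΦC x x∈B)
    tame-neg .cont B ε 0<ε =
      let δ , 0<δ , close = cont Φ-tame B ε 0<ε
      in δ , 0<δ , λ x y x∈B y∈B x≈y →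
           subst (_< ε) (sym (dist-neg (Φ x) (Φ y))) (close x y x∈B y∈B x≈y)

    tame-∣∣ : Tame (λ x → ∣ Φ x ∣)
    tame-∣∣ .bound B =
      let C , 0<C , ΦC = bound Φ-tame B
      in C , 0<C , λ x x∈B → subst (_< C) (sym (ℚ.∣∣p∣∣≡∣p∣ (Φ x))) (ΦC x x∈B)
    tame-∣∣ .cont B ε 0<ε =
      let δ , 0<δ , close = cont Φ-tame B ε 0<ε
      in δ , 0<δ , λ x y x∈B y∈B x≈y →
           ℚ.≤-<-trans (dist-∣∣ (Φ x) (Φ y)) (close x y x∈B y∈B x≈y)

  tame-- : ∀ {n} {Φ Ψ : (Fin n → ℚ) → ℚ} → Tame Φ → Tame Ψ → Tame (λ x → Φ x - Ψ x)
  tame-- Φ-tame Ψ-tame = tame-+ Φ-tame (tame-neg Ψ-tame)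

  -- The reciprocal of p ⊔ c, so that it is defined for all p.
  module Reciprocal {c : ℚ} (0<c : 0ℚ < c) where

    recip : ℚ → ℚ
    recip p = proj₁ (divide {p ⊔ c} (ℚ.<-≤-trans 0<c (ℚ.p≤q⊔p p c)) 0<1)

    0<recip : ∀ p → 0ℚ < recip p
    0<recip p = proj₁ (proj₂ (divide {p ⊔ c} (ℚ.<-≤-trans 0<c (ℚ.p≤q⊔p p c)) 0<1))

    recip-inverse : ∀ p → (p ⊔ c) * recip p ≡ 1ℚ
    recip-inverse p = proj₂ (proj₂ (divide {p ⊔ c} (ℚ.<-≤-trans 0<c (ℚ.p≤q⊔p p c)) 0<1))

    private
      R : ℚ
      R = proj₁ (divide {c} 0<c 0<1)
      0<R : 0ℚ < R
      0<R = proj₁ (proj₂ (divide {c} 0<c 0<1))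
      cR≡1 : c * R ≡ 1ℚ
      cR≡1 = proj₂ (proj₂ (divide {c} 0<c 0<1))

    -- Insert the factor `c * R`, enlarge its `c` to `p ⊔ c`, and cancel that against `recip p`.
    recip≤R : ∀ p → recip p ≤ R
    recip≤R p = begin
      r                 ≡⟨ ℚ.*-identityˡ r ⟨
      1ℚ * r            ≡⟨ cong (_* r) cR≡1 ⟨
      (c * R) * r       ≤⟨ ℚ.*-monoʳ-≤-nonNeg r {{nonneg r (0<recip p)}}
                             (ℚ.*-monoʳ-≤-nonNeg R {{nonneg R 0<R}} (ℚ.p≤q⊔p p c)) ⟩
      ((p ⊔ c) * R) * r ≡⟨ lemma (p ⊔ c) R r ⟩
      ((p ⊔ c) * r) * R ≡⟨ cong (_* R) (recip-inverse p) ⟩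
      1ℚ * R            ≡⟨ ℚ.*-identityˡ R ⟩
      R                 ∎
      where
      open ℚ.≤-Reasoning
      open +-*-Solver
      r : ℚ
      r = recip p
      nonneg : ∀ q → 0ℚ < q → ℚ.NonNegative q
      nonneg q 0<q = ℚ.nonNegative (ℚ.<⇒≤ 0<q)
      lemma : ∀ a b c → (a * b) * c ≡ (a * c) * b
      lemma = solve 3 (λ a b c → (a :* b) :* c := (a :* c) :* b) refl

    recip-diff : ∀ p q → recip p - recip q ≡ (recip p * recip q) * ((q ⊔ c) - (p ⊔ c))
    recip-diff p q = begin
      r - s                                 ≡⟨ cong₂ _-_ (ℚ.*-identityʳ r) (ℚ.*-identityʳ s) ⟨
      r * 1ℚ - s * 1ℚ                       ≡⟨ cong₂ (λ u v → r * u - s * v) (recip-inverse q) (recip-inverse p) ⟨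
      r * ((q ⊔ c) * s) - s * ((p ⊔ c) * r) ≡⟨ lemma r s (q ⊔ c) (p ⊔ c) ⟩
      (r * s) * ((q ⊔ c) - (p ⊔ c))         ∎
      where
      open ≡-Reasoning
      open +-*-Solver
      r s : ℚ
      r = recip p
      s = recip q
      lemma : ∀ r s u v → r * (u * s) - s * (v * r) ≡ (r * s) * (u - v)
      lemma = solve 4 (λ r s u v → r :* (u :* s) :- s :* (v :* r) := (r :* s) :* (u :- v)) refl

    ∣recip∣<R+1 : ∀ p → ∣ recip p ∣ < R + 1ℚ
    ∣recip∣<R+1 p = subst (_< R + 1ℚ) (sym (ℚ.0≤p⇒∣p∣≡p (ℚ.<⇒≤ (0<recip p))))
      (ℚ.≤-<-trans (recip≤R p) (subst (_< R + 1ℚ) (ℚ.+-identityʳ R) (ℚ.+-monoʳ-< R 0<1)))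

    0<R+1 : 0ℚ < R + 1ℚ
    0<R+1 = ℚ.+-mono-< {0ℚ} {R} {0ℚ} {1ℚ} 0<R 0<1

    -- By `recip-diff` the reciprocal is Lipschitz in `Φ x ⊔ c`, with constant
    -- `(R + 1ℚ) * (R + 1ℚ)`.
    tame-recip : ∀ {n} {Φ : (Fin n → ℚ) → ℚ} → Tame Φ → Tame (λ x → recip (Φ x))
    tame-recip {Φ = Φ} Φ-tame .bound B = R + 1ℚ , 0<R+1 , λ x _ → ∣recip∣<R+1 (Φ x)
    tame-recip {Φ = Φ} Φ-tame .cont B ε 0<ε =
      let δ , 0<δ , eq    = divide {(R + 1ℚ) * (R + 1ℚ)} {ε} 0<R² 0<ε
          η , 0<η , close = cont (tame-⊔ Φ-tame (tame-const c)) B δ 0<δ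
      in η , 0<η , λ x y x∈B y∈B x≈y →
        let r = recip (Φ x) ; s = recip (Φ y) ; d = (Φ y ⊔ c) - (Φ x ⊔ c) in
        subst₂ _<_
          (trans (sym (ℚ.∣p*q∣≡∣p∣*∣q∣ (r * s) d)) (cong ∣_∣ (sym (recip-diff (Φ x) (Φ y))))) eq
          (*-bound 0<R² {r * s} {d}
            (subst (_< (R + 1ℚ) * (R + 1ℚ)) (sym (ℚ.∣p*q∣≡∣p∣*∣q∣ r s))
              (*-bound 0<R+1 {r} {s} (∣recip∣<R+1 (Φ x)) (∣recip∣<R+1 (Φ y))))
            (subst (_< δ) (dist-sym (Φ x ⊔ c) (Φ y ⊔ c)) (close x y x∈B y∈B x≈y)))
      where
      0<R² : 0ℚ < (R + 1ℚ) * (R + 1ℚ)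
      0<R² = ℚ.positive⁻¹ _ {{ℚ.pos*pos⇒pos (R + 1ℚ) {{ℚ.positive 0<R+1}} (R + 1ℚ) {{ℚ.positive 0<R+1}}}}

-- Passage from rational approximations to real points

module Realization where
  open import Algebra.Bundles using (CommutativeRing)
  open import Data.Fin.Base using (Fin; zero; suc)
  open import Data.Nat.Base as ℕ using (ℕ; zero; suc)
  import Data.Nat.Properties as ℕ
  open import Data.Product.Base using (∃; _×_; _,_; proj₁; proj₂)
  open import Data.Rational.Base as ℚ
    using (ℚ; 0ℚ; 1ℚ; _+_; _*_; -_; _-_; ∣_∣; _<_; _≤_; _⊔_; _⊓_)
  import Data.Rational.Properties as ℚ
  open import Algebra.Properties.CommutativeMonoid.Sum ℚ.+-0-commutativeMonoid
    using (sum-cong-≗) renaming (sum to ∑) public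
  open import Algebra.Properties.Semiring.Sum (CommutativeRing.semiring ℚ.+-*-commutativeRing)
    using (*-distribˡ-sum)
  open import Data.Rational.Solver using (module +-*-Solver)
  open import Data.Sum.Base using (inj₁; inj₂)
  open import Function.Base using (_∘_)
  open import Level using (0ℓ)
  open import Relation.Binary.PropositionalEquality
  open import Relation.Unary using (Pred)

  open TameFunctions
  open Tame

  upper-bound : ∀ {n} (N : Fin n → ℕ) → ∃ λ M → ∀ i → N i ℕ.≤ M
  upper-bound {zero}  N = 0 , λ ()
  upper-bound {suc n} N =
    let M , N≤M = upper-bound (N ∘ suc)
    in N zero ℕ.⊔ M , λ { zero    → ℕ.m≤m⊔n (N zero) M
                        ; (suc i) → ℕ.≤-trans (N≤M i) (ℕ.m≤n⊔m (N zero) M) }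

  upper-boundℚ : ∀ {n} (B : Fin n → ℚ) → ∃ λ C → ∀ i → B i ≤ C
  upper-boundℚ {zero}  B = 0ℚ , λ ()
  upper-boundℚ {suc n} B =
    let C , B≤C = upper-boundℚ (B ∘ suc)
    in B zero ⊔ C , λ { zero    → ℚ.p≤p⊔q (B zero) C
                      ; (suc i) → ℚ.≤-trans (B≤C i) (ℚ.p≤q⊔p (B zero) C) }

  positive-lower-bound : ∀ {n} (δ : Fin n → ℚ) → (∀ i → 0ℚ < δ i) → ∃ λ η → 0ℚ < η × (∀ i → η ≤ δ i)
  positive-lower-bound {zero}  δ 0<δ = 1ℚ , 0<1 , λ ()
  positive-lower-bound {suc n} δ 0<δ =
    let η , 0<η , η≤δ = positive-lower-bound (δ ∘ suc) (0<δ ∘ suc)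
    in δ zero ⊓ η , 0<⊓ (0<δ zero) 0<η ,
       λ { zero    → ℚ.p⊓q≤p (δ zero) η
         ; (suc i) → ℚ.≤-trans (ℚ.p⊓q≤q (δ zero) η) (η≤δ i) }

  eventually-all : ∀ {k} {P : Fin k → Pred ℕ 0ℓ} → (∀ i → Eventually (P i)) →
                   Eventually (λ n → ∀ i → P i n)
  eventually-all ev =
    let M , N≤M = upper-bound (proj₁ ∘ ev)
    in M , λ n M≤n i → proj₂ (ev i) n (ℕ.≤-trans (N≤M i) M≤n)

  approx : ∀ {m} → (Fin m → ℝ) → ℕ → Fin m → ℚ
  approx x n i = seq (x i) n

  approx-box : ∀ {m} (x : Fin m → ℝ) → ∃ λ B → Eventually (λ n → Box B (approx x n))
  approx-box x =
    let C , B≤C = upper-boundℚ (λ i → proj₁ (bounded (x i)))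
    in C , eventually-all (λ i → eventually-map (λ n ∣x∣<B → ℚ.<-≤-trans ∣x∣<B (B≤C i))
                                   (proj₂ (proj₂ (bounded (x i)))))

  -- Late approximations of `x` lie in a common box, on which `Φ` is uniformly continuous; so the
  -- image sequence is again Cauchy.
  termwise : ∀ {m} {Φ : (Fin m → ℚ) → ℚ} → Tame Φ → (Fin m → ℝ) → ℝ
  termwise {Φ = Φ} _ x .seq n = Φ (approx x n)
  termwise {Φ = Φ} Φ-tame x .cauchy ε 0<ε =
    let B , N , x∈B = approx-box x
        δ , 0<δ , close = cont Φ-tame B ε 0<ε
        M , N≤M = upper-bound (λ i → proj₁ (cauchy (x i) δ 0<δ))
    in N ℕ.⊔ M , λ a b ≤a ≤b → close (approx x a) (approx x b)
         (x∈B a (ℕ.m⊔n≤o⇒m≤o N M ≤a)) (x∈B b (ℕ.m⊔n≤o⇒m≤o N M ≤b))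
         (λ i → proj₂ (cauchy (x i) δ 0<δ) a b
           (ℕ.≤-trans (N≤M i) (ℕ.m⊔n≤o⇒n≤o N M ≤a)) (ℕ.≤-trans (N≤M i) (ℕ.m⊔n≤o⇒n≤o N M ≤b)))

  module _ {m : ℕ} {Φ : (Fin m → ℚ) → ℚ} (Φ-tame : Tame Φ) (x : Fin m → ℝ) where

    -- `δ` has to be found before `y` is known. Capping it at 1 keeps the late approximations of
    -- every such `y` in the box of radius `B + 1ℚ`.
    termwise-close : ∀ ε → 0ℚ < ε → ∃ λ δ → 0ℚ < δ × (∀ y →
                     Eventually (λ n → Close δ (approx x n) (approx y n)) →
                     Eventually (λ n → ∣ Φ (approx x n) - Φ (approx y n) ∣ < ε))
    termwise-close ε 0<ε =
      let B , x∈B = approx-box x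
          δ , 0<δ , close = cont Φ-tame (B + 1ℚ) ε 0<ε
      in δ ⊓ 1ℚ , 0<⊓ 0<δ 0<1 , λ y → eventually-zip
           (λ n x∈B x≈y → close (approx x n) (approx y n)
             (λ i → ℚ.<-trans (x∈B i) (subst (_< B + 1ℚ) (ℚ.+-identityʳ B) (ℚ.+-monoʳ-< B 0<1)))
             (λ i → ℚ.≤-<-trans (∣p∣≤∣q∣+dist (seq (y i) n) (seq (x i) n))
                      (ℚ.+-mono-< (x∈B i) (ℚ.<-≤-trans
                        (subst (_< δ ⊓ 1ℚ) (dist-sym (seq (x i) n) (seq (y i) n)) (x≈y i))
                        (ℚ.p⊓q≤q δ 1ℚ))))
             (λ i → ℚ.<-≤-trans (x≈y i) (ℚ.p⊓q≤p δ 1ℚ)))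
           x∈B

  near⇒close : ∀ {m δ} {x y : Fin m → ℝ} → Near δ x y →
               Eventually (λ n → Close δ (approx x n) (approx y n))
  near⇒close {δ = δ} {x} {y} near = eventually-all (λ i →
    let η , 0<η , ev = near i
    in eventually-map (λ n η<δ-d → 0<q-p⇒p<q _ δ (ℚ.<-trans 0<η η<δ-d)) ev)
    where
    open +-*-Solver
    0<q-p⇒p<q : ∀ p q → 0ℚ < q - p → p < q
    0<q-p⇒p<q p q 0<q-p = subst₂ _<_ (ℚ.+-identityʳ p) (lemma p q) (ℚ.+-monoʳ-< p 0<q-p)
      where
      lemma : ∀ p q → p + (q - p) ≡ q
      lemma = solve 2 (λ p q → p :+ (q :- p) := q) refl

  termwise-continuous : ∀ {m k} {P : Pred (Fin m → ℝ) 0ℓ} {Q : Pred (Fin k → ℝ) 0ℓ}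
    {Φ : Fin k → (Fin m → ℚ) → ℚ} (Φ-tame : ∀ j → Tame (Φ j)) →
    (∀ x → P x → Q (λ j → termwise (Φ-tame j) x)) →
    ContinuousMap (subspace P) (subspace Q)
  termwise-continuous {P = P} {Q} {Φ} Φ-tame P⇒Q = record
    { func = record
      { to   = λ (x , Px) → (λ j → termwise (Φ-tame j) x) , P⇒Q x Px
      ; cong = λ {(x , _)} {(y , _)} x≈y j ε 0<ε →
          let δ , 0<δ , close = termwise-close (Φ-tame j) x ε 0<ε
          in close y (eventually-all (λ i → x≈y i δ 0<δ))
      }
    ; continuous = λ V-open (x , Px) Vx →
        let ε , 0<ε , ball = V-open _ Vx
            -- `Near` demands a fixed positive margin below `ε`; the second half of `ε` provides it.
            ε/2 , 0<ε/2 , half = halve 0<ε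
            near = λ j → termwise-close (Φ-tame j) x ε/2 0<ε/2
            δ , 0<δ , δ≤ = positive-lower-bound (λ j → proj₁ (near j)) (λ j → proj₁ (proj₂ (near j)))
        in δ , 0<δ , λ (y , Py) x≈y → ball _ (λ j →
             ε/2 , 0<ε/2 , eventually-map (λ n → gap _ half)
               (proj₂ (proj₂ (near j)) y
                 (eventually-map (λ n → close-mono {x = approx x n} {approx y n} (δ≤ j))
                   (near⇒close {x = x} {y} x≈y))))
    }

  seq-sum : ∀ {k} (x : Fin k → ℝ) n → seq (sum x) n ≡ ∑ (approx x n)
  seq-sum {zero}  x n = refl
  seq-sum {suc k} x n = cong (seq (x zero) n +_) (seq-sum (x ∘ suc) n)

  -- Normalization of rational vectors

  0≤p*p : ∀ p → 0ℚ ≤ p * p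
  0≤p*p p with ℚ.≤-total 0ℚ p
  ... | inj₁ 0≤p = subst (_≤ p * p) (ℚ.*-zeroˡ p) (ℚ.*-monoʳ-≤-nonNeg p {{ℚ.nonNegative 0≤p}} 0≤p)
  ... | inj₂ p≤0 = subst (_≤ p * p) (ℚ.*-zeroˡ p) (ℚ.*-monoʳ-≤-nonPos p {{ℚ.nonPositive p≤0}} p≤0)

  ∣p∣²≡p² : ∀ p → ∣ p ∣ * ∣ p ∣ ≡ p * p
  ∣p∣²≡p² p = trans (sym (ℚ.∣p*q∣≡∣p∣*∣q∣ p p)) (ℚ.0≤p⇒∣p∣≡p (0≤p*p p))

  square-mono : ∀ {p q} → 0ℚ ≤ p → p ≤ q → p * p ≤ q * q
  square-mono {p} {q} 0≤p p≤q = ℚ.≤-trans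
    (ℚ.*-monoˡ-≤-nonNeg p {{ℚ.nonNegative 0≤p}} p≤q)
    (ℚ.*-monoʳ-≤-nonNeg q {{ℚ.nonNegative (ℚ.≤-trans 0≤p p≤q)}} p≤q)

  -- A substitute for the Euclidean norm that needs no square root:
  -- the vector direction x has Euclidean norm gauge x, because
  -- (2as)² + (s² − a²)² = (s² + a²)² for a = ∣x₀∣ and s = a + n, where
  -- s² − a² = n(2a + n) and n is the gauge of the remaining coordinates.
  gauge : ∀ {k} → (Fin k → ℚ) → ℚ
  gauge {zero}  x = 0ℚ
  gauge {suc k} x = (∣ x zero ∣ + gauge (x ∘ suc)) * (∣ x zero ∣ + gauge (x ∘ suc)) + x zero * x zero

  direction : ∀ {k} → (Fin k → ℚ) → Fin k → ℚ
  direction x zero    = (x zero + x zero) * (∣ x zero ∣ + gauge (x ∘ suc))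
  direction x (suc i) = (∣ x zero ∣ + ∣ x zero ∣ + gauge (x ∘ suc)) * direction (x ∘ suc) i

  ∣direction∣²≡gauge² : ∀ {k} (x : Fin k → ℚ) →
                        ∑ (λ i → direction x i * direction x i) ≡ gauge x * gauge x
  ∣direction∣²≡gauge² {zero}  x = refl
  ∣direction∣²≡gauge² {suc k} x = begin
    d₀ * d₀ + ∑ (λ i → (c * d i) * (c * d i)) ≡⟨ cong (d₀ * d₀ +_) (sum-cong-≗ (λ i → swap c (d i))) ⟩
    d₀ * d₀ + ∑ (λ i → (c * c) * (d i * d i)) ≡⟨ cong (d₀ * d₀ +_) (*-distribˡ-sum (c * c) (λ i → d i * d i)) ⟨
    d₀ * d₀ + (c * c) * ∑ (λ i → d i * d i)   ≡⟨ cong (λ s → d₀ * d₀ + (c * c) * s) (∣direction∣²≡gauge² (x ∘ suc)) ⟩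
    d₀ * d₀ + (c * c) * (n * n)               ≡⟨ cong (_+ (c * c) * (n * n)) (expand x₀ (a + n)) ⟩
    (x₀ * x₀) * q + (c * c) * (n * n)         ≡⟨ cong (λ s → s * q + (c * c) * (n * n)) (∣p∣²≡p² x₀) ⟨
    (a * a) * q + (c * c) * (n * n)           ≡⟨ pythagoras a n ⟩
    ((a + n) * (a + n) + a * a) * ((a + n) * (a + n) + a * a)
                                              ≡⟨ cong (λ s → ((a + n) * (a + n) + s) * ((a + n) * (a + n) + s)) (∣p∣²≡p² x₀) ⟩
    gauge x * gauge x                         ∎
    where
    open ≡-Reasoning
    open +-*-Solver
    x₀ a n c d₀ q : ℚ
    x₀ = x zero
    a  = ∣ x₀ ∣
    n  = gauge (x ∘ suc)
    c  = a + a + n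
    d₀ = direction x zero
    -- This is 4(a + n)², spelled out in the form produced by `expand`.
    q  = (a + n) * (a + n) + (a + n) * (a + n) + ((a + n) * (a + n) + (a + n) * (a + n))
    d : Fin k → ℚ
    d = direction (x ∘ suc)
    swap : ∀ c d → (c * d) * (c * d) ≡ (c * c) * (d * d)
    swap = solve 2 (λ c d → (c :* d) :* (c :* d) := (c :* c) :* (d :* d)) refl
    expand : ∀ x s → ((x + x) * s) * ((x + x) * s) ≡ (x * x) * (s * s + s * s + (s * s + s * s))
    expand = solve 2 (λ x s → ((x :+ x) :* s) :* ((x :+ x) :* s) :=
      (x :* x) :* (s :* s :+ s :* s :+ (s :* s :+ s :* s))) refl
    pythagoras : ∀ a n →
      (a * a) * ((a + n) * (a + n) + (a + n) * (a + n) + ((a + n) * (a + n) + (a + n) * (a + n)))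
        + ((a + a + n) * (a + a + n)) * (n * n) ≡
      ((a + n) * (a + n) + a * a) * ((a + n) * (a + n) + a * a)
    pythagoras = solve 2 (λ a n → let s² = (a :+ n) :* (a :+ n) in
      (a :* a) :* (s² :+ s² :+ (s² :+ s²)) :+ ((a :+ a :+ n) :* (a :+ a :+ n)) :* (n :* n) :=
      (s² :+ a :* a) :* (s² :+ a :* a)) refl

  0≤gauge : ∀ {k} (x : Fin k → ℚ) → 0ℚ ≤ gauge x
  0≤gauge {zero}  x = ℚ.≤-refl
  0≤gauge {suc k} x = ℚ.+-mono-≤ (0≤p*p (∣ x zero ∣ + gauge (x ∘ suc))) (0≤p*p (x zero))

  -- Follows the recursion of `gauge`, keeping only the smaller of its two summands. In dimension 0
  -- there is no entry to bound, and 1 merely serves as a positive value.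
  gauge-floor : ℕ → ℚ → ℚ
  gauge-floor zero    δ = 1ℚ
  gauge-floor (suc k) δ = (gauge-floor k δ * gauge-floor k δ) ⊓ (δ * δ)

  0<gauge-floor : ∀ k {δ} → 0ℚ < δ → 0ℚ < gauge-floor k δ
  0<gauge-floor zero    0<δ = 0<1
  0<gauge-floor (suc k) 0<δ = 0<⊓ (square-pos (0<gauge-floor k 0<δ)) (square-pos 0<δ)
    where
    square-pos : ∀ {p} → 0ℚ < p → 0ℚ < p * p
    square-pos {p} 0<p = ℚ.positive⁻¹ _ {{ℚ.pos*pos⇒pos p {{ℚ.positive 0<p}} p {{ℚ.positive 0<p}}}}

  gauge-floor≤gauge : ∀ {k δ} → 0ℚ < δ → (x : Fin k → ℚ) → ∀ i → δ ≤ ∣ x i ∣ → gauge-floor k δ ≤ gauge x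
  gauge-floor≤gauge {suc k} {δ} 0<δ x zero δ≤∣x∣ = begin
    gauge-floor (suc k) δ         ≤⟨ ℚ.p⊓q≤q (gauge-floor k δ * gauge-floor k δ) (δ * δ) ⟩
    δ * δ                         ≤⟨ square-mono (ℚ.<⇒≤ 0<δ) δ≤∣x∣ ⟩
    ∣ x zero ∣ * ∣ x zero ∣       ≡⟨ ∣p∣²≡p² (x zero) ⟩
    x zero * x zero               ≡⟨ ℚ.+-identityˡ _ ⟨
    0ℚ + x zero * x zero          ≤⟨ ℚ.+-monoˡ-≤ _ (0≤p*p (∣ x zero ∣ + gauge (x ∘ suc))) ⟩
    gauge x                       ∎
    where open ℚ.≤-Reasoning
  gauge-floor≤gauge {suc k} {δ} 0<δ x (suc i) δ≤∣x∣ = begin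
    gauge-floor (suc k) δ                         ≤⟨ ℚ.p⊓q≤p (gauge-floor k δ * gauge-floor k δ) (δ * δ) ⟩
    gauge-floor k δ * gauge-floor k δ             ≤⟨ square-mono (ℚ.<⇒≤ (0<gauge-floor k 0<δ)) floor≤ ⟩
    s * s                                         ≡⟨ ℚ.+-identityʳ (s * s) ⟨
    s * s + 0ℚ                                    ≤⟨ ℚ.+-monoʳ-≤ (s * s) (0≤p*p (x zero)) ⟩
    gauge x                                       ∎
    where
    open ℚ.≤-Reasoning
    s : ℚ
    s = ∣ x zero ∣ + gauge (x ∘ suc)
    floor≤ : gauge-floor k δ ≤ ∣ x zero ∣ + gauge (x ∘ suc)
    floor≤ = ℚ.≤-trans (gauge-floor≤gauge 0<δ (x ∘ suc) i δ≤∣x∣)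
      (subst (_≤ ∣ x zero ∣ + gauge (x ∘ suc)) (ℚ.+-identityˡ _)
        (ℚ.+-monoˡ-≤ (gauge (x ∘ suc)) (ℚ.0≤∣p∣ (x zero))))

  ∣∣-cong-neg : ∀ {p q} → p ≡ - q → ∣ p ∣ ≡ ∣ q ∣
  ∣∣-cong-neg {q = q} p≡-q = trans (cong ∣_∣ p≡-q) (ℚ.∣-p∣≡∣p∣ q)

  gauge-even : ∀ {k} {x y : Fin k → ℚ} → (∀ i → x i ≡ - y i) → gauge x ≡ gauge y
  gauge-even {zero}  x≡-y = refl
  gauge-even {suc k} {x} {y} x≡-y = cong₂ _+_
    (cong (λ s → s * s) (cong₂ _+_ (∣∣-cong-neg (x≡-y zero)) (gauge-even (x≡-y ∘ suc))))
    (trans (sym (∣p∣²≡p² (x zero))) (trans (cong (λ s → s * s) (∣∣-cong-neg (x≡-y zero))) (∣p∣²≡p² (y zero))))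

  direction-odd : ∀ {k} {x y : Fin k → ℚ} → (∀ i → x i ≡ - y i) → ∀ i → direction x i ≡ - direction y i
  direction-odd {x = x} {y} x≡-y zero = begin
    (x zero + x zero) * (∣ x zero ∣ + gauge (x ∘ suc))
      ≡⟨ cong₂ (λ p q → (p + p) * q) (x≡-y zero)
           (cong₂ _+_ (∣∣-cong-neg (x≡-y zero)) (gauge-even (x≡-y ∘ suc))) ⟩
    (- y zero + - y zero) * (∣ y zero ∣ + gauge (y ∘ suc))
      ≡⟨ lemma (y zero) (∣ y zero ∣ + gauge (y ∘ suc)) ⟩
    - ((y zero + y zero) * (∣ y zero ∣ + gauge (y ∘ suc))) ∎
    where
    open ≡-Reasoning
    open +-*-Solver
    lemma : ∀ p q → (- p + - p) * q ≡ - ((p + p) * q)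
    lemma = solve 2 (λ p q → (:- p :+ :- p) :* q := :- ((p :+ p) :* q)) refl
  direction-odd {x = x} {y} x≡-y (suc i) = trans
    (cong₂ _*_
      (cong₂ (λ a n → a + a + n) (∣∣-cong-neg (x≡-y zero)) (gauge-even (x≡-y ∘ suc)))
      (direction-odd (x≡-y ∘ suc) i))
    (sym (ℚ.neg-distribʳ-* (∣ y zero ∣ + ∣ y zero ∣ + gauge (y ∘ suc)) (direction (y ∘ suc) i)))

  tame-gauge : ∀ {m k} {Φ : Fin k → (Fin m → ℚ) → ℚ} → (∀ j → Tame (Φ j)) →
               Tame (λ t → gauge (λ j → Φ j t))
  tame-gauge {k = zero}  Φ-tame = tame-const 0ℚ
  tame-gauge {k = suc k} Φ-tame = tame-+ (tame-* s-tame s-tame) (tame-* (Φ-tame zero) (Φ-tame zero))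
    where
    s-tame = tame-+ (tame-∣∣ (Φ-tame zero)) (tame-gauge (Φ-tame ∘ suc))

  tame-direction : ∀ {m k} {Φ : Fin k → (Fin m → ℚ) → ℚ} → (∀ j → Tame (Φ j)) →
                   ∀ i → Tame (λ t → direction (λ j → Φ j t) i)
  tame-direction Φ-tame zero = tame-* (tame-+ (Φ-tame zero) (Φ-tame zero))
    (tame-+ (tame-∣∣ (Φ-tame zero)) (tame-gauge (Φ-tame ∘ suc)))
  tame-direction Φ-tame (suc i) = tame-*
    (tame-+ (tame-+ (tame-∣∣ (Φ-tame zero)) (tame-∣∣ (Φ-tame zero))) (tame-gauge (Φ-tame ∘ suc)))
    (tame-direction (Φ-tame ∘ suc) i)

  -- Equivariant maps to the sphere from odd tame functions

  module ToSphere (K : SimplicialComplex) (τ : FreeInvolution K) {k : ℕ}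
    (f : Fin k → (Fin (SimplicialComplex.vertices K) → ℚ) → ℚ)
    (f-tame : ∀ j → Tame (f j))
    (f-odd : ∀ j t → f j (t ∘ FreeInvolution.ν τ) ≡ - f j t)
    {δ : ℚ} (0<δ : 0ℚ < δ)
    -- The coordinate `j` may vary with `n`: it is found by comparing rationals, and no coordinate
    -- of the limit has to be singled out.
    (f-nonzero : ∀ x → InRealization K x → Eventually (λ n → ∃ λ j → δ ≤ ∣ f j (approx x n) ∣))
    where

    open Reciprocal (0<gauge-floor k 0<δ)

    g : Fin k → (Fin (SimplicialComplex.vertices K) → ℚ) → ℚ
    g i t = direction (λ j → f j t) i * recip (gauge (λ j → f j t))

    g-tame : ∀ i → Tame (g i)
    g-tame i = tame-* (tame-direction f-tame i) (tame-recip (tame-gauge f-tame))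

    g-odd : ∀ i t → g i (t ∘ FreeInvolution.ν τ) ≡ - g i t
    g-odd i t = trans
      (cong₂ _*_ (direction-odd (λ j → f-odd j t) i) (cong recip (gauge-even (λ j → f-odd j t))))
      (sym (ℚ.neg-distribˡ-* (direction (λ j → f j t) i) (recip (gauge (λ j → f j t)))))

    -- Here the gauge is at least its floor, so `recip` is its true inverse and cancels the norm of
    -- `direction`.
    g-norm : ∀ t j → δ ≤ ∣ f j t ∣ → ∑ (λ i → g i t * g i t) ≡ 1ℚ
    g-norm t j δ≤ = begin
      ∑ (λ i → (d i * r) * (d i * r)) ≡⟨ sum-cong-≗ (λ i → swap (d i) r) ⟩
      ∑ (λ i → (r * r) * (d i * d i)) ≡⟨ *-distribˡ-sum (r * r) (λ i → d i * d i) ⟨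
      (r * r) * ∑ (λ i → d i * d i)   ≡⟨ cong ((r * r) *_) (∣direction∣²≡gauge² (λ j → f j t)) ⟩
      (r * r) * (n * n)               ≡⟨ regroup r n ⟩
      (n * r) * (n * r)               ≡⟨ cong (λ s → s * s) nr≡1 ⟩
      1ℚ                              ∎
      where
      open ≡-Reasoning
      open +-*-Solver
      n r : ℚ
      n = gauge (λ j → f j t)
      r = recip n
      d : Fin k → ℚ
      d = direction (λ j → f j t)
      swap : ∀ d r → (d * r) * (d * r) ≡ (r * r) * (d * d)
      swap = solve 2 (λ d r → (d :* r) :* (d :* r) := (r :* r) :* (d :* d)) refl
      regroup : ∀ r n → (r * r) * (n * n) ≡ (n * r) * (n * r)
      regroup = solve 2 (λ r n → (r :* r) :* (n :* n) := (n :* r) :* (n :* r)) refl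
      nr≡1 : n * r ≡ 1ℚ
      nr≡1 = trans (cong (_* r) (sym (ℚ.p≥q⇒p⊔q≡p (gauge-floor≤gauge 0<δ (λ j → f j t) j δ≤))))
               (recip-inverse n)

    toSphere : ℤ₂-Map ∥ K , τ ∥ (UnitSphere k)
    toSphere = record
      -- Late approximations land exactly on the sphere, so the sum of squares is eventually equal
      -- to 1.
      { map = termwise-continuous g-tame (λ x x∈K ε 0<ε → eventually-map
          (λ n (j , δ≤) → subst (_< ε) (sym (trans
            (cong (λ s → ∣ s - 1ℚ ∣) (trans
              (seq-sum (λ i → termwise (g-tame i) x *ℝ termwise (g-tame i) x) n)
              (g-norm (approx x n) j δ≤)))
            (dist-refl 1ℚ))) 0<ε)
          (f-nonzero x x∈K))
      ; equivariant = λ (x , _) i → ≗⇒≈ℝ {termwise (g-tame i) (x ∘ FreeInvolution.ν τ)}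
          { -ℝ termwise (g-tame i) x} (λ n → g-odd i (approx x n))
      }

-- Extrema, sums, signs and weights indexed by subsets

module Subsets where
  open import Data.Fin.Base using (Fin; zero; suc)
  open import Data.Fin.Subset using (Subset; inside; outside; _∈_; _⊆_; ∁)
  open import Data.Fin.Subset.Properties using (x∉p⇒x∈∁p; _∈?_)
  open import Data.Nat.Base as ℕ using (ℕ)
  open import Data.Product.Base using (∃; _×_; _,_)
  open import Data.Rational.Base as ℚ
    using (ℚ; 0ℚ; 1ℚ; _+_; _*_; -_; _-_; ∣_∣; _<_; _≤_; _⊔_; _⊓_)
  import Data.Rational.Properties as ℚ
  open import Data.Rational.Solver using (module +-*-Solver)
  open import Data.Sum.Base using (_⊎_; inj₁; inj₂)
  open import Data.Vec.Base using ([]; _∷_; here; there)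
  open import Function.Base using (_∘_)
  open import Relation.Binary.PropositionalEquality
  open import Relation.Nullary

  open TameFunctions

  -- Over the empty set these are 1 and 0; so infimum ≤ 1 and supremum ≥ 0.
  infimum supremum : ∀ {n} → Subset n → (Fin n → ℚ) → ℚ
  infimum []            z = 1ℚ
  infimum (inside ∷ A)  z = z zero ⊓ infimum A (z ∘ suc)
  infimum (outside ∷ A) z = infimum A (z ∘ suc)
  supremum []            z = 0ℚ
  supremum (inside ∷ A)  z = z zero ⊔ supremum A (z ∘ suc)
  supremum (outside ∷ A) z = supremum A (z ∘ suc)

  infimum-cong : ∀ {n} (A : Subset n) {y z} → (∀ v → y v ≡ z v) → infimum A y ≡ infimum A z
  infimum-cong []            y≗z = refl
  infimum-cong (inside ∷ A)  y≗z = cong₂ _⊓_ (y≗z zero) (infimum-cong A (y≗z ∘ suc))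
  infimum-cong (outside ∷ A) y≗z = infimum-cong A (y≗z ∘ suc)

  supremum-cong : ∀ {n} (A : Subset n) {y z} → (∀ v → y v ≡ z v) → supremum A y ≡ supremum A z
  supremum-cong []            y≗z = refl
  supremum-cong (inside ∷ A)  y≗z = cong₂ _⊔_ (y≗z zero) (supremum-cong A (y≗z ∘ suc))
  supremum-cong (outside ∷ A) y≗z = supremum-cong A (y≗z ∘ suc)

  infimum-lower : ∀ {n} (A : Subset n) z {v} → v ∈ A → infimum A z ≤ z v
  infimum-lower (inside ∷ A)  z here        = ℚ.p⊓q≤p (z zero) _
  infimum-lower (inside ∷ A)  z (there v∈A) =
    ℚ.≤-trans (ℚ.p⊓q≤q (z zero) _) (infimum-lower A (z ∘ suc) v∈A)
  infimum-lower (outside ∷ A) z (there v∈A) = infimum-lower A (z ∘ suc) v∈A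

  infimum-greatest : ∀ {n} (A : Subset n) z {c} → c ≤ 1ℚ → (∀ {v} → v ∈ A → c ≤ z v) → c ≤ infimum A z
  infimum-greatest []            z c≤1 c≤z = c≤1
  infimum-greatest (inside ∷ A)  z c≤1 c≤z =
    ℚ.⊓-glb (c≤z here) (infimum-greatest A (z ∘ suc) c≤1 (c≤z ∘ there))
  infimum-greatest (outside ∷ A) z c≤1 c≤z = infimum-greatest A (z ∘ suc) c≤1 (c≤z ∘ there)

  supremum-upper : ∀ {n} (A : Subset n) z {v} → v ∈ A → z v ≤ supremum A z
  supremum-upper (inside ∷ A)  z here        = ℚ.p≤p⊔q (z zero) _
  supremum-upper (inside ∷ A)  z (there v∈A) =
    ℚ.≤-trans (supremum-upper A (z ∘ suc) v∈A) (ℚ.p≤q⊔p (z zero) _)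
  supremum-upper (outside ∷ A) z (there v∈A) = supremum-upper A (z ∘ suc) v∈A

  supremum-least : ∀ {n} (A : Subset n) z {c} → 0ℚ ≤ c → (∀ {v} → v ∈ A → z v ≤ c) → supremum A z ≤ c
  supremum-least []            z 0≤c z≤c = 0≤c
  supremum-least (inside ∷ A)  z 0≤c z≤c =
    ℚ.⊔-lub (z≤c here) (supremum-least A (z ∘ suc) 0≤c (z≤c ∘ there))
  supremum-least (outside ∷ A) z 0≤c z≤c = supremum-least A (z ∘ suc) 0≤c (z≤c ∘ there)

  0≤supremum : ∀ {n} (A : Subset n) z → 0ℚ ≤ supremum A z
  0≤supremum []            z = ℚ.≤-refl
  0≤supremum (inside ∷ A)  z = ℚ.≤-trans (0≤supremum A (z ∘ suc)) (ℚ.p≤q⊔p (z zero) _)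
  0≤supremum (outside ∷ A) z = 0≤supremum A (z ∘ suc)

  supremum-attained : ∀ {n} (A : Subset n) z →
                      supremum A z ≡ 0ℚ ⊎ ∃ λ v → supremum A z ≡ z v
  supremum-attained []            z = inj₁ refl
  supremum-attained (outside ∷ A) z with supremum-attained A (z ∘ suc)
  ... | inj₁ eq       = inj₁ eq
  ... | inj₂ (v , eq) = inj₂ (suc v , eq)
  supremum-attained (inside ∷ A) z with ℚ.⊔-sel (z zero) (supremum A (z ∘ suc)) | supremum-attained A (z ∘ suc)
  ... | inj₁ eq | _              = inj₂ (zero , eq)
  ... | inj₂ eq | inj₁ eq′       = inj₁ (trans eq eq′)
  ... | inj₂ eq | inj₂ (v , eq′) = inj₂ (suc v , trans eq eq′)

  ∑ₛ : ∀ {n} → (Subset n → ℚ) → ℚ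
  ∑ₛ {ℕ.zero}  g = g []
  ∑ₛ {ℕ.suc n} g = ∑ₛ (g ∘ (inside ∷_)) + ∑ₛ (g ∘ (outside ∷_))

  ∑ₛ-cong : ∀ {n} {g h : Subset n → ℚ} → (∀ A → g A ≡ h A) → ∑ₛ g ≡ ∑ₛ h
  ∑ₛ-cong {ℕ.zero}  g≗h = g≗h []
  ∑ₛ-cong {ℕ.suc n} g≗h = cong₂ _+_ (∑ₛ-cong (g≗h ∘ (inside ∷_))) (∑ₛ-cong (g≗h ∘ (outside ∷_)))

  ∑ₛ-*ˡ : ∀ {n} c (g : Subset n → ℚ) → c * ∑ₛ g ≡ ∑ₛ (λ A → c * g A)
  ∑ₛ-*ˡ {ℕ.zero}  c g = refl
  ∑ₛ-*ˡ {ℕ.suc n} c g = trans (ℚ.*-distribˡ-+ c (∑ₛ (g ∘ (inside ∷_))) (∑ₛ (g ∘ (outside ∷_))))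
    (cong₂ _+_ (∑ₛ-*ˡ c (g ∘ (inside ∷_))) (∑ₛ-*ˡ c (g ∘ (outside ∷_))))

  ∑ₛ-neg : ∀ {n} (g : Subset n → ℚ) → ∑ₛ (λ A → - g A) ≡ - ∑ₛ g
  ∑ₛ-neg {ℕ.zero}  g = refl
  ∑ₛ-neg {ℕ.suc n} g = trans (cong₂ _+_ (∑ₛ-neg (g ∘ (inside ∷_))) (∑ₛ-neg (g ∘ (outside ∷_))))
    (sym (ℚ.neg-distrib-+ (∑ₛ (g ∘ (inside ∷_))) (∑ₛ (g ∘ (outside ∷_)))))

  ∑ₛ-+ : ∀ {n} (g h : Subset n → ℚ) → ∑ₛ (λ A → g A + h A) ≡ ∑ₛ g + ∑ₛ h
  ∑ₛ-+ {ℕ.zero}  g h = refl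
  ∑ₛ-+ {ℕ.suc n} g h = trans (cong₂ _+_ (∑ₛ-+ (g ∘ (inside ∷_)) (h ∘ (inside ∷_))) (∑ₛ-+ (g ∘ (outside ∷_)) (h ∘ (outside ∷_))))
    (interchange (∑ₛ (g ∘ (inside ∷_))) (∑ₛ (h ∘ (inside ∷_))) (∑ₛ (g ∘ (outside ∷_))) (∑ₛ (h ∘ (outside ∷_))))
    where
    open +-*-Solver
    interchange : ∀ p q r s → (p + q) + (r + s) ≡ (p + r) + (q + s)
    interchange = solve 4 (λ p q r s → (p :+ q) :+ (r :+ s) := (p :+ r) :+ (q :+ s)) refl

  ∑ₛ-comm : ∀ {m n} (g : Subset m → Subset n → ℚ) →
            ∑ₛ (λ A → ∑ₛ (λ B → g A B)) ≡ ∑ₛ (λ B → ∑ₛ (λ A → g A B))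
  ∑ₛ-comm {ℕ.zero}  g = refl
  ∑ₛ-comm {ℕ.suc m} g = trans
    (cong₂ _+_ (∑ₛ-comm (g ∘ (inside ∷_))) (∑ₛ-comm (g ∘ (outside ∷_))))
    (sym (∑ₛ-+ (λ B → ∑ₛ (λ A → g (inside ∷ A) B)) (λ B → ∑ₛ (λ A → g (outside ∷ A) B))))

  0≤∑ₛ : ∀ {n} {g : Subset n → ℚ} → (∀ A → 0ℚ ≤ g A) → 0ℚ ≤ ∑ₛ g
  0≤∑ₛ {ℕ.zero}  0≤g = 0≤g []
  0≤∑ₛ {ℕ.suc n} 0≤g = ℚ.+-mono-≤ (0≤∑ₛ (0≤g ∘ (inside ∷_))) (0≤∑ₛ (0≤g ∘ (outside ∷_)))

  term≤∑ₛ : ∀ {n} {g : Subset n → ℚ} → (∀ A → 0ℚ ≤ g A) → ∀ A → g A ≤ ∑ₛ g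
  term≤∑ₛ {g = g} 0≤g []            = ℚ.≤-refl
  term≤∑ₛ {g = g} 0≤g (inside ∷ A)  = subst (_≤ ∑ₛ g) (ℚ.+-identityʳ _)
    (ℚ.+-mono-≤ (term≤∑ₛ (0≤g ∘ (inside ∷_)) A) (0≤∑ₛ (0≤g ∘ (outside ∷_))))
  term≤∑ₛ {g = g} 0≤g (outside ∷ A) = subst (_≤ ∑ₛ g) (ℚ.+-identityˡ _)
    (ℚ.+-mono-≤ (0≤∑ₛ (0≤g ∘ (inside ∷_))) (term≤∑ₛ (0≤g ∘ (outside ∷_)) A))

  -- The lexicographic order serves as an explicit antisymmetric choice that is nonzero off the
  -- diagonal.
  sgn : ∀ {n} → Subset n → Subset n → ℚ
  sgn []            []            = 0ℚ
  sgn (inside ∷ p)  (inside ∷ q)  = sgn p q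
  sgn (inside ∷ p)  (outside ∷ q) = 1ℚ
  sgn (outside ∷ p) (inside ∷ q)  = - 1ℚ
  sgn (outside ∷ p) (outside ∷ q) = sgn p q

  sgn-antisym : ∀ {n} (p q : Subset n) → sgn p q ≡ - sgn q p
  sgn-antisym []            []            = refl
  sgn-antisym (inside ∷ p)  (inside ∷ q)  = sgn-antisym p q
  sgn-antisym (inside ∷ p)  (outside ∷ q) = refl
  sgn-antisym (outside ∷ p) (inside ∷ q)  = refl
  sgn-antisym (outside ∷ p) (outside ∷ q) = sgn-antisym p q

  ∣sgn∣≡1 : ∀ {n} (p q : Subset n) → p ≢ q → ∣ sgn p q ∣ ≡ 1ℚ
  ∣sgn∣≡1 []            []            p≢q = contradiction refl p≢q
  ∣sgn∣≡1 (inside ∷ p)  (inside ∷ q)  p≢q = ∣sgn∣≡1 p q (p≢q ∘ cong (inside ∷_))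
  ∣sgn∣≡1 (inside ∷ p)  (outside ∷ q) p≢q = refl
  ∣sgn∣≡1 (outside ∷ p) (inside ∷ q)  p≢q = refl
  ∣sgn∣≡1 (outside ∷ p) (outside ∷ q) p≢q = ∣sgn∣≡1 p q (p≢q ∘ cong (outside ∷_))

  tame-infimum : ∀ {m n} (A : Subset n) {Φ : Fin n → (Fin m → ℚ) → ℚ} → (∀ v → Tame (Φ v)) →
                 Tame (λ t → infimum A (λ v → Φ v t))
  tame-infimum []            Φ-tame = tame-const 1ℚ
  tame-infimum (inside ∷ A)  Φ-tame = tame-⊓ (Φ-tame zero) (tame-infimum A (Φ-tame ∘ suc))
  tame-infimum (outside ∷ A) Φ-tame = tame-infimum A (Φ-tame ∘ suc)

  tame-supremum : ∀ {m n} (A : Subset n) {Φ : Fin n → (Fin m → ℚ) → ℚ} → (∀ v → Tame (Φ v)) →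
                  Tame (λ t → supremum A (λ v → Φ v t))
  tame-supremum []            Φ-tame = tame-const 0ℚ
  tame-supremum (inside ∷ A)  Φ-tame = tame-⊔ (Φ-tame zero) (tame-supremum A (Φ-tame ∘ suc))
  tame-supremum (outside ∷ A) Φ-tame = tame-supremum A (Φ-tame ∘ suc)

  tame-∑ₛ : ∀ {m n} {Φ : Subset n → (Fin m → ℚ) → ℚ} → (∀ A → Tame (Φ A)) →
            Tame (λ t → ∑ₛ (λ A → Φ A t))
  tame-∑ₛ {n = ℕ.zero}  Φ-tame = Φ-tame []
  tame-∑ₛ {n = ℕ.suc n} Φ-tame =
    tame-+ (tame-∑ₛ (Φ-tame ∘ (inside ∷_))) (tame-∑ₛ (Φ-tame ∘ (outside ∷_)))

  module Weight {n : ℕ} where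

    -- For 0 ≤ c < 1, `A` and `B` are the sets where `y`, respectively `z`, exceeds c exactly if c
    -- is at least `bottom A B y z` and below `top A B y z`. The default values confine these levels
    -- to the unit interval.
    top bottom : Subset n → Subset n → (y z : Fin n → ℚ) → ℚ
    top    A B y z = infimum A y ⊓ infimum B z
    bottom A B y z = supremum (∁ A) y ⊔ supremum (∁ B) z

    -- Up to a scalar, the coordinate at A ⊎ B of the point with barycentric
    -- coordinates y, z in the barycentric subdivision.
    weight : Subset n → Subset n → (y z : Fin n → ℚ) → ℚ
    weight A B y z = 0ℚ ⊔ (top A B y z - bottom A B y z)

    weight-sym : ∀ A B y z → weight A B y z ≡ weight B A z y
    weight-sym A B y z = cong₂ (λ p q → 0ℚ ⊔ (p - q))
      (ℚ.⊓-comm (infimum A y) (infimum B z)) (ℚ.⊔-comm (supremum (∁ A) y) (supremum (∁ B) z))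

    weight-cong : ∀ A B {y y′ z z′} → (∀ v → y v ≡ y′ v) → (∀ v → z v ≡ z′ v) →
                  weight A B y z ≡ weight A B y′ z′
    weight-cong A B y≗ z≗ = cong₂ (λ p q → 0ℚ ⊔ (p - q))
      (cong₂ _⊓_ (infimum-cong A y≗) (infimum-cong B z≗))
      (cong₂ _⊔_ (supremum-cong (∁ A) y≗) (supremum-cong (∁ B) z≗))

    0≤weight : ∀ A B y z → 0ℚ ≤ weight A B y z
    0≤weight A B y z = ℚ.p≤p⊔q 0ℚ (top A B y z - bottom A B y z)

    tame-weight : ∀ {m} A B {Φ Ψ : Fin n → (Fin m → ℚ) → ℚ} → (∀ v → Tame (Φ v)) → (∀ v → Tame (Ψ v)) →
                  Tame (λ t → weight A B (λ v → Φ v t) (λ v → Ψ v t))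
    tame-weight A B Φ-tame Ψ-tame = tame-⊔ (tame-const 0ℚ) (tame--
      (tame-⊓ (tame-infimum A Φ-tame) (tame-infimum B Ψ-tame))
      (tame-⊔ (tame-supremum (∁ A) Φ-tame) (tame-supremum (∁ B) Ψ-tame)))

    module _ {y z : Fin n → ℚ} where
      -- The value of `y` at a node of `C` outside `A` would be at least `top C D y z` and at most
      -- `bottom A B y z`. The same holds for `D`, `B` and `z`.
      bottom<top⇒⊇ : ∀ A B C D → bottom A B y z < top C D y z → C ⊆ A × D ⊆ B
      bottom<top⇒⊇ A B C D bot<top = C⊆A , D⊆B
        where
        C⊆A : C ⊆ A
        C⊆A {v} v∈C with v ∈? A
        ... | yes v∈A = v∈A
        ... | no v∉A  = contradiction (ℚ.<-≤-trans bot<top (ℚ.≤-trans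
          (ℚ.≤-trans (ℚ.p⊓q≤p (infimum C y) (infimum D z)) (infimum-lower C y v∈C))
          (ℚ.≤-trans (supremum-upper (∁ A) y (x∉p⇒x∈∁p v∉A)) (ℚ.p≤p⊔q _ (supremum (∁ B) z))))) (ℚ.<-irrefl refl)
        D⊆B : D ⊆ B
        D⊆B {v} v∈D with v ∈? B
        ... | yes v∈B = v∈B
        ... | no v∉B  = contradiction (ℚ.<-≤-trans bot<top (ℚ.≤-trans
          (ℚ.≤-trans (ℚ.p⊓q≤q (infimum C y) (infimum D z)) (infimum-lower D z v∈D))
          (ℚ.≤-trans (supremum-upper (∁ B) z (x∉p⇒x∈∁p v∉B)) (ℚ.p≤q⊔p (supremum (∁ A) y) _)))) (ℚ.<-irrefl refl)

      0<weight⇒bottom<top : ∀ A B → 0ℚ < weight A B y z → bottom A B y z < top A B y z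
      0<weight⇒bottom<top A B 0<w = ℚ.≰⇒> (λ top≤bot → ℚ.<-irrefl refl (ℚ.<-≤-trans 0<w
        (ℚ.⊔-lub ℚ.≤-refl (subst (top A B y z - bottom A B y z ≤_)
          (ℚ.+-inverseʳ (bottom A B y z)) (ℚ.+-monoˡ-≤ (- bottom A B y z) top≤bot)))))

      -- Pairs of positive weight are level sets, which form a chain: if `bottom A B y z` is not
      -- below `top C D y z`, all levels of `C`, `D` lie below those of `A`, `B`.
      weight-comparable : ∀ A B C D → 0ℚ < weight A B y z → 0ℚ < weight C D y z →
                          (A ⊆ C × B ⊆ D) ⊎ (C ⊆ A × D ⊆ B)
      weight-comparable A B C D 0<w 0<w′ with bottom A B y z ℚ.<? top C D y z
      ... | yes < = inj₂ (bottom<top⇒⊇ A B C D <)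
      ... | no ≮  = inj₁ (bottom<top⇒⊇ C D A B (ℚ.<-trans (0<weight⇒bottom<top C D 0<w′)
                      (ℚ.≤-<-trans (ℚ.≮⇒≥ ≮) (0<weight⇒bottom<top A B 0<w))))

-- Natural multiples of rationals

module Multiples where
  open import Data.Fin.Base using (Fin; zero; suc)
  open import Data.Nat.Base as ℕ using (ℕ; zero; suc)
  import Data.Nat.Properties as ℕ
  open import Data.Product.Base using (∃; _×_; _,_)
  open import Data.Rational.Base as ℚ using (ℚ; 0ℚ; 1ℚ; _+_; _*_; _<_; _≤_)
  import Data.Rational.Properties as ℚ
  open import Function.Base using (_∘_)
  open import Relation.Binary.PropositionalEquality
  open Realization using (∑)

  infixr 7 _·_

  -- By recursion, a multiple such as `6 · δ` unfolds to a sum, the form in which it is handed to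
  -- the ring solver.
  _·_ : ℕ → ℚ → ℚ
  zero  · p = 0ℚ
  suc k · p = p + k · p

  ·-+ : ∀ j k p → (j ℕ.+ k) · p ≡ j · p + k · p
  ·-+ zero    k p = sym (ℚ.+-identityˡ (k · p))
  ·-+ (suc j) k p = trans (cong (p +_) (·-+ j k p)) (sym (ℚ.+-assoc p (j · p) (k · p)))

  ·-* : ∀ j k p → (j ℕ.* k) · p ≡ j · k · p
  ·-* zero    k p = refl
  ·-* (suc j) k p = trans (·-+ k (j ℕ.* k) p) (cong (k · p +_) (·-* j k p))

  ·1-* : ∀ k p → (k · 1ℚ) * p ≡ k · p
  ·1-* zero    p = ℚ.*-zeroˡ p
  ·1-* (suc k) p = trans (ℚ.*-distribʳ-+ p 1ℚ (k · 1ℚ)) (cong₂ _+_ (ℚ.*-identityˡ p) (·1-* k p))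

  0≤· : ∀ k {p} → 0ℚ ≤ p → 0ℚ ≤ k · p
  0≤· zero    0≤p = ℚ.≤-refl
  0≤· (suc k) 0≤p = ℚ.+-mono-≤ 0≤p (0≤· k 0≤p)

  ·-monoˡ : ∀ {j k p} → 0ℚ ≤ p → j ℕ.≤ k → j · p ≤ k · p
  ·-monoˡ {k = k} 0≤p ℕ.z≤n = 0≤· k 0≤p
  ·-monoˡ {p = p} 0≤p (ℕ.s≤s j≤k) = ℚ.+-monoʳ-≤ p (·-monoˡ 0≤p j≤k)

  ·-monoʳ : ∀ k {p q} → p ≤ q → k · p ≤ k · q
  ·-monoʳ zero    p≤q = ℚ.≤-refl
  ·-monoʳ (suc k) p≤q = ℚ.+-mono-≤ p≤q (·-monoʳ k p≤q)

  ∑≤· : ∀ {n} (x : Fin n → ℚ) {c} → (∀ v → x v ≤ c) → ∑ x ≤ n · c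
  ∑≤· {zero}  x x≤c = ℚ.≤-refl
  ∑≤· {suc n} x x≤c = ℚ.+-mono-≤ (x≤c zero) (∑≤· (x ∘ suc) (x≤c ∘ suc))

  unit-fraction : ∀ k → ∃ λ δ → 0ℚ < δ × suc k · δ ≡ 1ℚ
  unit-fraction k =
    let δ , 0<δ , eq = divide {suc k · 1ℚ} {1ℚ} (ℚ.+-mono-<-≤ 0<1 (0≤· k (ℚ.<⇒≤ 0<1))) 0<1
    in δ , 0<δ , trans (sym (·1-* (suc k) δ)) eq

-- Level sets of the excess functions

module BoxMap (G : Graph) where
  open import Data.Fin.Base using (Fin)
  open import Data.Fin.Subset using (Subset; _∈_; _∉_; _⊆_; ⊤; ∁; ∣_∣)
  open import Data.Fin.Subset.Properties
    using (_∈?_; x∈∁p⇒x∉p; x∉p⇒x∈∁p; ∣p∣≤n; p⊆q⇒∣p∣≤∣q∣)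
  open import Data.Nat.Base as ℕ using (ℕ; zero; suc)
  import Data.Nat.Properties as ℕ
  open import Data.Product.Base using (∃; ∃₂; _×_; _,_; proj₁; proj₂)
  open import Data.Rational.Base as ℚ
    using (ℚ; 0ℚ; 1ℚ; _+_; -_; _-_; _<_; _≤_)
  import Data.Rational.Properties as ℚ
  open import Data.Rational.Solver using (module +-*-Solver)
  open import Data.Sum.Base using (_⊎_; inj₁; inj₂)
  open import Function.Base using (_∘_)
  open import Relation.Binary.PropositionalEquality
  open import Relation.Nullary

  open Graph G renaming (order to n)
  open Bicliques G
  open TameFunctions
  open Realization
  open Subsets
  open Weight {n}
  open Multiples

  module Gap {y z : Fin n → ℚ} {δ : ℚ} (0<δ : 0ℚ < δ)
    (K : ℕ) (n+n<K : n ℕ.+ n ℕ.< K) (Kδ≤1 : K · δ ≤ 1ℚ)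
    (∃y : ∃ λ v → K · δ ≤ y v) (∃z : ∃ λ v → K · δ ≤ z v)
    (adjacent : ∀ {v w} → 0ℚ < y v + z w → Adj v w) where

    private
      0≤δ : 0ℚ ≤ δ
      0≤δ = ℚ.<⇒≤ 0<δ

    level : (Fin n → ℚ) → ℕ → Subset n
    level x j = select (λ v → j · δ ℚ.≤? x v)

    ∈-level⁺ : ∀ x j {v} → j · δ ≤ x v → v ∈ level x j
    ∈-level⁺ x j = ∈-select⁺ (λ v → j · δ ℚ.≤? x v)

    ∈-level⁻ : ∀ x j {v} → v ∈ level x j → j · δ ≤ x v
    ∈-level⁻ x j = ∈-select⁻ (λ v → j · δ ℚ.≤? x v)

    level-antitone : ∀ x {i j} → i ℕ.≤ j → level x j ⊆ level x i
    level-antitone x {i} {j} i≤j v∈ = ∈-level⁺ x i (ℚ.≤-trans (·-monoˡ 0≤δ i≤j) (∈-level⁻ x j v∈))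

    size : ℕ → ℕ
    size j = ∣ level y j ∣ ℕ.+ ∣ level z j ∣

    -- If `s` dropped at each of the `K` steps, `s 0` would be at least `K + s K`.
    stationary : ∀ K (s : ℕ → ℕ) → s 0 ℕ.< K ℕ.+ s K → ∃ λ j → j ℕ.< K × s j ℕ.≤ s (suc j)
    stationary zero    s s0< = contradiction s0< (ℕ.<-irrefl refl)
    stationary (suc K) s s0< with s K ℕ.≤? s (suc K)
    ... | yes ≤ = K , ℕ.n<1+n K , ≤
    ... | no ≰  =
      let j , j<K , ≤ = stationary K s (ℕ.<-≤-trans s0<
            (subst (ℕ._≤ K ℕ.+ s K) (ℕ.+-suc K (s (suc K))) (ℕ.+-monoʳ-≤ K (ℕ.≰⇒> ≰))))
      in j , ℕ.m<n⇒m<1+n j<K , ≤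

    gap-exists : ∃ λ j → j ℕ.< K × size j ℕ.≤ size (suc j)
    gap-exists = stationary K size (ℕ.≤-<-trans (ℕ.+-mono-≤ (∣p∣≤n (level y 0)) (∣p∣≤n (level z 0)))
      (ℕ.<-≤-trans n+n<K (ℕ.m≤m+n K (size K))))

    -- If `size` does not drop from `j` to `suc j`, no value of `y` or `z` is at least `j · δ` but
    -- below `suc j · δ`. This gap of length `δ` becomes the weight of the level sets.
    heavy-biclique : ∃₂ λ A B → Biclique A B × δ ≤ weight A B y z
    heavy-biclique with gap-exists
    ... | j , j<K , size≤ = A , B , biclique A≢∅ B≢∅ A⊆cnB , δ≤weight
      where
      A B : Subset n
      -- The upper end of the gap is positive even for `j = 0`, which makes the sums in `adjacent`
      -- positive.
      A = level y (suc j)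
      B = level z (suc j)

      A≢∅ : ∃ λ v → v ∈ A
      A≢∅ = proj₁ ∃y , level-antitone y j<K (∈-level⁺ y K (proj₂ ∃y))
      B≢∅ : ∃ λ v → v ∈ B
      B≢∅ = proj₁ ∃z , level-antitone z j<K (∈-level⁺ z K (proj₂ ∃z))

      0<1+jδ : 0ℚ < suc j · δ
      0<1+jδ = ℚ.+-mono-<-≤ 0<δ (0≤· j 0≤δ)

      A⊆cnB : A ⊆ cn B
      A⊆cnB {v} v∈A = ∈-cn⁺ (λ {w} w∈B → adj-sym (adjacent
        (ℚ.+-mono-< {0ℚ} {y v} {0ℚ} {z w} (ℚ.<-≤-trans 0<1+jδ (∈-level⁻ y (suc j) v∈A))
          (ℚ.<-≤-trans 0<1+jδ (∈-level⁻ z (suc j) w∈B)))))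

      same-sizes : ∣ level y j ∣ ℕ.≤ ∣ A ∣ × ∣ level z j ∣ ℕ.≤ ∣ B ∣
      same-sizes = +-squeeze (p⊆q⇒∣p∣≤∣q∣ (level-antitone y (ℕ.n≤1+n j)))
        (p⊆q⇒∣p∣≤∣q∣ (level-antitone z (ℕ.n≤1+n j))) size≤

      outside≤ : ∀ x → ∣ level x j ∣ ℕ.≤ ∣ level x (suc j) ∣ → supremum (∁ (level x (suc j))) x ≤ j · δ
      outside≤ x ∣∣≤ = supremum-least _ x (0≤· j 0≤δ) (λ {v} v∈∁ → ℚ.<⇒≤ (ℚ.≰⇒> (λ jδ≤x →
        x∈∁p⇒x∉p v∈∁ (⊆∧∣≥∣⇒⊇ (level-antitone x (ℕ.n≤1+n j)) ∣∣≤ (∈-level⁺ x j jδ≤x)))))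

      bottom≤ : bottom A B y z ≤ j · δ
      bottom≤ = ℚ.⊔-lub (outside≤ y (proj₁ same-sizes)) (outside≤ z (proj₂ same-sizes))

      ≤top : suc j · δ ≤ top A B y z
      ≤top = ℚ.⊓-glb (infimum-greatest A y 1+jδ≤1 (∈-level⁻ y (suc j))) (infimum-greatest B z 1+jδ≤1 (∈-level⁻ z (suc j)))
        where
        1+jδ≤1 : suc j · δ ≤ 1ℚ
        -- The default value of `infimum` caps `top` at 1, so the levels have to stay below that.
        1+jδ≤1 = ℚ.≤-trans (·-monoˡ 0≤δ j<K) Kδ≤1

      δ≤weight : δ ≤ weight A B y z
      δ≤weight = begin
        δ                            ≡⟨ lemma δ (j · δ) ⟩
        suc j · δ - j · δ            ≤⟨ ℚ.+-mono-≤ ≤top (ℚ.neg-antimono-≤ bottom≤) ⟩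
        top A B y z - bottom A B y z ≤⟨ ℚ.p≤q⊔p 0ℚ _ ⟩
        weight A B y z               ∎
        where
        open ℚ.≤-Reasoning
        open +-*-Solver
        lemma : ∀ p q → p ≡ (p + q) - q
        lemma = solve 2 (λ p q → p := (p :+ q) :- q) refl

  nonneighbours : Node → Subset n
  nonneighbours v = ∁ (select (adj? v))

  nonadjacent⇒∈ : ∀ {v w} → ¬ Adj v w → w ∈ nonneighbours v
  nonadjacent⇒∈ {v} ¬v~w = x∉p⇒x∈∁p (¬v~w ∘ ∈-select⁻ (adj? v))

  ∈⇒nonadjacent : ∀ {v w} → w ∈ nonneighbours v → ¬ Adj v w
  ∈⇒nonadjacent {v} w∈ v~w = x∈∁p⇒x∉p w∈ (∈-select⁺ (adj? v) v~w)

  -- Subtracting the largest coordinate x w over nonneighbours w of v makes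
  -- the sets {excess t x > c} and {excess x t > c} completely adjacent for
  -- c ≥ 0; the other summands shift the two functions to a common maximum.
  excess : (t x : Fin n → ℚ) → Fin n → ℚ
  excess t x v = (supremum ⊤ x - supremum ⊤ t) + (d + d)
    where
    d : ℚ
    d = t v - supremum (nonneighbours v) x

  excess-cong : ∀ {t t′ x x′} → (∀ v → t v ≡ t′ v) → (∀ v → x v ≡ x′ v) →
                ∀ v → excess t x v ≡ excess t′ x′ v
  excess-cong {t} {t′} {x} {x′} t≗ x≗ v = cong₂ _+_
    (cong₂ _-_ (supremum-cong ⊤ x≗) (supremum-cong ⊤ t≗)) (cong₂ _+_ d≡ d≡)
    where
    d≡ : t v - supremum (nonneighbours v) x ≡ t′ v - supremum (nonneighbours v) x′
    d≡ = cong₂ _-_ (t≗ v) (supremum-cong (nonneighbours v) x≗)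

  -- The shifts `b - a` and `a - b` cancel, and twice `(t v - mw) + (x w - mv)` is left. If `v` and
  -- `w` are not adjacent, each is among the nonneighbours of the other, so neither difference is
  -- positive.
  excess-adjacent : ∀ t x {v w} → 0ℚ < excess t x v + excess x t w → Adj v w
  excess-adjacent t x {v} {w} 0<sum with adj? v w
  ... | yes v~w = v~w
  ... | no ¬v~w = contradiction (ℚ.<-≤-trans 0<sum sum≤0) (ℚ.<-irrefl refl)
    where
    open ℚ.≤-Reasoning
    open +-*-Solver
    a b mv mw p : ℚ
    a  = supremum ⊤ t
    b  = supremum ⊤ x
    mv = supremum (nonneighbours v) x
    mw = supremum (nonneighbours w) t
    p  = (t v - mw) + (x w - mv)
    rearrange : ∀ a b tv xw mv mw →
      ((b - a) + ((tv - mv) + (tv - mv))) + ((a - b) + ((xw - mw) + (xw - mw))) ≡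
      ((tv - mw) + (xw - mv)) + ((tv - mw) + (xw - mv))
    rearrange = solve 6 (λ a b tv xw mv mw →
      ((b :- a) :+ ((tv :- mv) :+ (tv :- mv))) :+ ((a :- b) :+ ((xw :- mw) :+ (xw :- mw))) :=
      ((tv :- mw) :+ (xw :- mv)) :+ ((tv :- mw) :+ (xw :- mv))) refl
    p-q≤0 : ∀ {p q} → p ≤ q → p - q ≤ 0ℚ
    p-q≤0 {p} {q} p≤q = subst (p - q ≤_) (ℚ.+-inverseʳ q) (ℚ.+-monoˡ-≤ (- q) p≤q)
    p≤0 : p ≤ 0ℚ
    p≤0 = ℚ.+-mono-≤ {t v - mw} {0ℚ} {x w - mv} {0ℚ}
      (p-q≤0 (supremum-upper (nonneighbours w) t (nonadjacent⇒∈ (¬v~w ∘ adj-sym))))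
      (p-q≤0 (supremum-upper (nonneighbours v) x (nonadjacent⇒∈ ¬v~w)))
    sum≤0 : excess t x v + excess x t w ≤ 0ℚ
    sum≤0 = begin
      excess t x v + excess x t w ≡⟨ rearrange a b (t v) (x w) mv mw ⟩
      p + p                       ≤⟨ ℚ.+-mono-≤ {p} {0ℚ} {p} {0ℚ} p≤0 p≤0 ⟩
      0ℚ                          ∎

  ≤-by-difference : ∀ {p q} d → 0ℚ ≤ d → p + d ≡ q → p ≤ q
  ≤-by-difference {p} d 0≤d eq = subst₂ _≤_ (ℚ.+-identityʳ p) eq (ℚ.+-monoʳ-≤ p 0≤d)

  0≤q-p : ∀ {p q} → p ≤ q → 0ℚ ≤ q - p
  0≤q-p {p} {q} p≤q = subst (_≤ q - p) (ℚ.+-inverseʳ p) (ℚ.+-monoˡ-≤ (- p) p≤q)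

  -- In the exact case, the nonneighbours of a maximizer of `t` in `A` lie outside `B`, so nothing
  -- is subtracted there and the excess is (b - a) + 2a = a + b. If `t` is nowhere larger than `δ`,
  -- a common neighbour of `B` replaces the maximizer.
  excess-large : ∀ {t x A B δ} → 0ℚ ≤ δ → A ⊆ cn B → ∃ (CN B) → (∀ v → - δ ≤ t v) →
    (∀ v → v ∉ A → t v ≤ δ) → (∀ v → v ∉ B → x v ≤ δ) →
    ∃ λ v → (supremum ⊤ t + supremum ⊤ x) - 6 · δ ≤ excess t x v
  excess-large {t} {x} {A} {B} {δ} 0≤δ A⊆cnB (u , B~u) -δ≤t t≤δ x≤δ = choose (supremum-attained ⊤ t)
    where
    open +-*-Solver
    a b : ℚ
    a = supremum ⊤ t
    b = supremum ⊤ x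

    nonneighbours-small : ∀ {v} → CN B v → supremum (nonneighbours v) x ≤ δ
    nonneighbours-small {v} B~v = supremum-least (nonneighbours v) x 0≤δ
      (λ {w} w∈ → x≤δ w (λ w∈B → ∈⇒nonadjacent w∈ (adj-sym (B~v w∈B))))

    small : a ≤ δ → ∃ λ v → (a + b) - 6 · δ ≤ excess t x v
    -- The estimates `m ≤ δ`, `- δ ≤ t u` and `a ≤ δ` cost two `δ` each, which makes 6.
    small a≤δ = u , ≤-by-difference
      (((δ - m) + (δ - m)) + (((t u - (- δ)) + (t u - (- δ))) + ((δ - a) + (δ - a))))
      (ℚ.+-mono-≤ (ℚ.+-mono-≤ 0≤δ-m 0≤δ-m) (ℚ.+-mono-≤ (ℚ.+-mono-≤ 0≤t+δ 0≤t+δ) (ℚ.+-mono-≤ (0≤q-p a≤δ) (0≤q-p a≤δ))))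
      (identity a b (t u) m δ)
      where
      m : ℚ
      m = supremum (nonneighbours u) x
      0≤δ-m : 0ℚ ≤ δ - m
      0≤δ-m = 0≤q-p (nonneighbours-small B~u)
      0≤t+δ : 0ℚ ≤ t u - (- δ)
      0≤t+δ = 0≤q-p (-δ≤t u)
      identity : ∀ a b t m δ →
        ((a + b) - 6 · δ) + (((δ - m) + (δ - m)) + (((t - (- δ)) + (t - (- δ))) + ((δ - a) + (δ - a)))) ≡
        (b - a) + ((t - m) + (t - m))
      identity = solve 5 (λ a b t m δ →
        ((a :+ b) :- (δ :+ (δ :+ (δ :+ (δ :+ (δ :+ (δ :+ con 0ℚ)))))))
          :+ (((δ :- m) :+ (δ :- m)) :+ (((t :- (:- δ)) :+ (t :- (:- δ))) :+ ((δ :- a) :+ (δ :- a)))) :=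
        (b :- a) :+ ((t :- m) :+ (t :- m))) refl

    choose : a ≡ 0ℚ ⊎ (∃ λ v → a ≡ t v) → ∃ λ v → (a + b) - 6 · δ ≤ excess t x v
    choose (inj₁ a≡0) = small (subst (_≤ δ) (sym a≡0) 0≤δ)
    choose (inj₂ (v , a≡t)) with v ∈? A
    ... | no v∉A  = small (subst (_≤ δ) (sym a≡t) (t≤δ v v∉A))
    -- Only `m ≤ δ` costs anything here; the remaining `4 · δ` is slack.
    ... | yes v∈A = v , ≤-by-difference
      (((δ - m) + (δ - m)) + 4 · δ)
      (ℚ.+-mono-≤ (ℚ.+-mono-≤ 0≤δ-m 0≤δ-m) (0≤· 4 0≤δ))
      (trans (identity a b m δ) (cong (λ s → (b - a) + ((s - m) + (s - m))) a≡t))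
      where
      m : ℚ
      m = supremum (nonneighbours v) x
      0≤δ-m : 0ℚ ≤ δ - m
      0≤δ-m = 0≤q-p (nonneighbours-small (∈-cn⁻ (A⊆cnB v∈A)))
      identity : ∀ a b m δ →
        ((a + b) - 6 · δ) + (((δ - m) + (δ - m)) + 4 · δ) ≡ (b - a) + ((a - m) + (a - m))
      identity = solve 4 (λ a b m δ →
        ((a :+ b) :- (δ :+ (δ :+ (δ :+ (δ :+ (δ :+ (δ :+ con 0ℚ)))))))
          :+ (((δ :- m) :+ (δ :- m)) :+ (δ :+ (δ :+ (δ :+ (δ :+ con 0ℚ))))) :=
        (b :- a) :+ ((a :- m) :+ (a :- m))) refl

  tame-excess : ∀ {m} {Φ Ψ : Fin n → (Fin m → ℚ) → ℚ} → (∀ v → Tame (Φ v)) → (∀ v → Tame (Ψ v)) →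
                ∀ v → Tame (λ t → excess (λ w → Φ w t) (λ w → Ψ w t) v)
  tame-excess Φ-tame Ψ-tame v = tame-+
    (tame-- (tame-supremum ⊤ Ψ-tame) (tame-supremum ⊤ Φ-tame)) (tame-+ d-tame d-tame)
    where
    d-tame = tame-- (Φ-tame v) (tame-supremum (nonneighbours v) Ψ-tame)

-- The odd coordinate functions and their common zeros

module Coordinates (G : Graph) (ℓ m : ℕ) (ℓ≥1 : ℓ ≥ 1) (m≥1 : m ≥ 1) (¬K : ¬ Graph.ContainsK G ℓ m) where
  open import Data.Fin.Base using (Fin; toℕ; fromℕ<; splitAt; join; _↑ˡ_; _↑ʳ_)
  open import Data.Fin.Properties
    using (toℕ-fromℕ<; splitAt-↑ˡ; splitAt-↑ʳ; join-splitAt)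
  open import Data.Fin.Subset using (Subset; _∉_; _⊆_; ⊤)
  open import Data.Fin.Subset.Properties using (_∈?_; ∈⊤)
  open import Data.Nat.Base as ℕ using (suc; _∸_)
  import Data.Nat.Properties as ℕ
  open import Data.Integer.Base using (_⊖_)
  open import Data.Product.Base using (∃; _×_; _,_; proj₁; proj₂)
  open import Data.Rational.Base as ℚ
    using (ℚ; 0ℚ; 1ℚ; _+_; _*_; -_; _-_; ∣_∣; _<_; _≤_)
  import Data.Rational.Properties as ℚ
  open import Data.Rational.Solver using (module +-*-Solver)
  open import Data.Sum.Base as Sum using (_⊎_; inj₁; inj₂)
  open import Data.Vec.Base using (_++_)
  open import Data.Vec.Properties using ([]=⇒lookup; lookup⇒[]=; lookup-++ˡ; lookup-++ʳ)
  open import Function.Base using (_∘_)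
  open import Relation.Binary.PropositionalEquality
  open import Relation.Nullary

  open Graph G renaming (order to n)
  open Bicliques G
  open Rank ℓ m
  open BoxMap G
  open TameFunctions
  open Realization
  open Subsets
  open Weight {n}
  open Multiples

  k : ℕ
  k = ℓ ℕ.+ m ∸ 2

  private
    free : BicliqueFree ℓ m
    free = ¬ContainsK⇒bicliqueFree ¬K

  -- The sign is taken from `cn A` and `cn B` because `rank-strict` shows these, and not `A` and
  -- `B`, to agree on nested bicliques of equal rank.
  coefficient : Fin k → Subset n → Subset n → ℚ
  coefficient j A B with biclique? A B | rank A B ℕ.≟ toℕ j
  ... | yes _ | yes _ = sgn (cn A) (cn B)
  ... | yes _ | no _  = 0ℚ
  ... | no _  | _     = 0ℚ

  coefficient-biclique : ∀ {j A B} → Biclique A B → rank A B ≡ toℕ j → coefficient j A B ≡ sgn (cn A) (cn B)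
  coefficient-biclique {j} {A} {B} b r≡j with biclique? A B | rank A B ℕ.≟ toℕ j
  ... | yes _ | yes _  = refl
  ... | yes _ | no r≢j = contradiction r≡j r≢j
  ... | no ¬b | _      = contradiction b ¬b

  coefficient-cases : ∀ j A B → coefficient j A B ≡ 0ℚ ⊎ (Biclique A B × rank A B ≡ toℕ j)
  coefficient-cases j A B with biclique? A B | rank A B ℕ.≟ toℕ j
  ... | yes b | yes r≡j = inj₂ (b , r≡j)
  ... | yes _ | no _    = inj₁ refl
  ... | no _  | _       = inj₁ refl

  coefficient-antisym : ∀ j A B → coefficient j A B ≡ - coefficient j B A
  coefficient-antisym j A B = by-cases (coefficient-cases j A B) (coefficient-cases j B A)
    where
    open ≡-Reasoning
    Case : Subset n → Subset n → Set
    Case A B = coefficient j A B ≡ 0ℚ ⊎ (Biclique A B × rank A B ≡ toℕ j)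
    by-cases : Case A B → Case B A → coefficient j A B ≡ - coefficient j B A
    by-cases (inj₂ (b , r≡j)) _ = begin
      coefficient j A B     ≡⟨ coefficient-biclique b r≡j ⟩
      sgn (cn A) (cn B)     ≡⟨ sgn-antisym (cn A) (cn B) ⟩
      - sgn (cn B) (cn A)   ≡⟨ cong -_ (coefficient-biclique (biclique-sym b) (trans (rank-sym B A) r≡j)) ⟨
      - coefficient j B A   ∎
    by-cases (inj₁ _) (inj₂ (b , r≡j)) = begin
      coefficient j A B     ≡⟨ coefficient-biclique (biclique-sym b) (trans (rank-sym A B) r≡j) ⟩
      sgn (cn A) (cn B)     ≡⟨ sgn-antisym (cn A) (cn B) ⟩
      - sgn (cn B) (cn A)   ≡⟨ cong -_ (coefficient-biclique b r≡j) ⟨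
      - coefficient j B A   ∎
    by-cases (inj₁ eq) (inj₁ eq′) = trans eq (cong -_ (sym eq′))

  F : Fin k → (y z : Fin n → ℚ) → ℚ
  F j y z = ∑ₛ (λ A → ∑ₛ (λ B → coefficient j A B * weight A B y z))

  F-cong : ∀ j {y y′ z z′} → (∀ v → y v ≡ y′ v) → (∀ v → z v ≡ z′ v) → F j y z ≡ F j y′ z′
  F-cong j y≗ z≗ = ∑ₛ-cong (λ A → ∑ₛ-cong (λ B → cong (coefficient j A B *_) (weight-cong A B y≗ z≗)))

  F-antisym : ∀ j y z → F j z y ≡ - F j y z
  F-antisym j y z = begin
    ∑ₛ (λ A → ∑ₛ (λ B → coefficient j A B * weight A B z y))     ≡⟨ ∑ₛ-cong (λ A → ∑ₛ-cong (λ B → swap A B)) ⟩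
    ∑ₛ (λ A → ∑ₛ (λ B → - (coefficient j B A * weight B A y z))) ≡⟨ ∑ₛ-cong (λ A → ∑ₛ-neg (λ B → coefficient j B A * weight B A y z)) ⟩
    ∑ₛ (λ A → - ∑ₛ (λ B → coefficient j B A * weight B A y z))   ≡⟨ ∑ₛ-neg (λ A → ∑ₛ (λ B → coefficient j B A * weight B A y z)) ⟩
    - ∑ₛ (λ A → ∑ₛ (λ B → coefficient j B A * weight B A y z))   ≡⟨ cong -_ (∑ₛ-comm (λ A B → coefficient j B A * weight B A y z)) ⟩
    - F j y z                                                    ∎
    where
    open ≡-Reasoning
    swap : ∀ A B → coefficient j A B * weight A B z y ≡ - (coefficient j B A * weight B A y z)
    swap A B = trans (cong₂ _*_ (coefficient-antisym j A B) (weight-sym A B z y))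
      (sym (ℚ.neg-distribˡ-* (coefficient j B A) (weight B A y z)))

  -- After multiplication by the sign `s` of the given biclique no summand is negative: a biclique
  -- of the same rank and of positive weight is nested with it, so by `rank-strict` it has the same
  -- sign. Hence the single summand at `A`, `B` bounds the sum from below.
  F-large : ∀ {y z A B δ} → 0ℚ < δ → Biclique A B → δ ≤ weight A B y z → ∃ λ j → δ ≤ ∣ F j y z ∣
  F-large {y} {z} {A} {B} {δ} 0<δ b δ≤w = j , (begin
    δ                           ≤⟨ δ≤w ⟩
    weight A B y z              ≡⟨ signed-weight (weight A B y z) ⟨
    s * (s * weight A B y z)    ≡⟨ cong (λ c → s * (c * weight A B y z)) (coefficient-biclique b rank≡j) ⟨
    term A B                    ≤⟨ term≤∑ₛ (0≤term A) B ⟩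
    ∑ₛ (term A)                 ≤⟨ term≤∑ₛ (λ A → 0≤∑ₛ (0≤term A)) A ⟩
    ∑ₛ (λ A → ∑ₛ (term A))      ≡⟨ ∑ₛ-cong (λ A → ∑ₛ-*ˡ s (λ B → coefficient j A B * weight A B y z)) ⟨
    ∑ₛ (λ A → s * ∑ₛ (λ B → coefficient j A B * weight A B y z))
                                ≡⟨ ∑ₛ-*ˡ s (λ A → ∑ₛ (λ B → coefficient j A B * weight A B y z)) ⟨
    s * F j y z                 ≤⟨ p≤∣p∣ (s * F j y z) ⟩
    ∣ s * F j y z ∣             ≡⟨ ℚ.∣p*q∣≡∣p∣*∣q∣ s (F j y z) ⟩
    ∣ s ∣ * ∣ F j y z ∣         ≡⟨ cong (_* ∣ F j y z ∣) ∣s∣≡1 ⟩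
    1ℚ * ∣ F j y z ∣            ≡⟨ ℚ.*-identityˡ ∣ F j y z ∣ ⟩
    ∣ F j y z ∣                 ∎)
    where
    open ℚ.≤-Reasoning
    rank<k : rank A B ℕ.< k
    rank<k = rank-bound free ℓ≥1 m≥1 b

    j : Fin k
    j = fromℕ< rank<k

    rank≡j : rank A B ≡ toℕ j
    rank≡j = sym (toℕ-fromℕ< rank<k)

    s : ℚ
    s = sgn (cn A) (cn B)

    ∣s∣≡1 : ∣ s ∣ ≡ 1ℚ
    ∣s∣≡1 = ∣sgn∣≡1 (cn A) (cn B) (biclique⇒cn≢ b)

    signed-weight : ∀ w → s * (s * w) ≡ w
    signed-weight w = trans (sym (ℚ.*-assoc s s w)) (trans
      (cong (_* w) (trans (sym (∣p∣²≡p² s)) (cong (λ c → c * c) ∣s∣≡1)))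
      (ℚ.*-identityˡ w))

    term : Subset n → Subset n → ℚ
    term C D = s * (coefficient j C D * weight C D y z)

    same-cn : ∀ {C D} → Biclique C D → rank C D ≡ toℕ j → 0ℚ < weight C D y z →
              cn C ≡ cn A × cn D ≡ cn B
    same-cn {C} {D} c r≡j 0<w = compare (weight-comparable C D A B 0<w (ℚ.<-≤-trans 0<δ δ≤w))
      where
      compare : (C ⊆ A × D ⊆ B) ⊎ (A ⊆ C × B ⊆ D) → cn C ≡ cn A × cn D ≡ cn B
      compare (inj₁ (C⊆A , D⊆B)) = rank-strict free ℓ≥1 m≥1 c b C⊆A D⊆B (trans r≡j (sym rank≡j))
      compare (inj₂ (A⊆C , B⊆D)) =
        let A≡ , B≡ = rank-strict free ℓ≥1 m≥1 b c A⊆C B⊆D (trans rank≡j (sym r≡j)) in sym A≡ , sym B≡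

    0≤term : ∀ C D → 0ℚ ≤ term C D
    0≤term C D = by-cases (coefficient-cases j C D) (0ℚ ℚ.<? weight C D y z)
      where
      by-cases : coefficient j C D ≡ 0ℚ ⊎ (Biclique C D × rank C D ≡ toℕ j) →
                 Dec (0ℚ < weight C D y z) → 0ℚ ≤ term C D
      by-cases (inj₁ eq) _ = ℚ.≤-reflexive (sym (trans
        (cong (λ c → s * (c * weight C D y z)) eq)
        (trans (cong (s *_) (ℚ.*-zeroˡ (weight C D y z))) (ℚ.*-zeroʳ s))))
      by-cases (inj₂ _) (no ≮) = ℚ.≤-reflexive (sym (trans
        (cong (λ w → s * (coefficient j C D * w)) (ℚ.≤-antisym (ℚ.≮⇒≥ ≮) (0≤weight C D y z)))
        (trans (cong (s *_) (ℚ.*-zeroʳ (coefficient j C D))) (ℚ.*-zeroʳ s))))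
      by-cases (inj₂ (c , r≡j)) (yes 0<w) = subst (0ℚ ≤_) (sym (trans
        (cong (λ c → s * (c * weight C D y z)) (trans (coefficient-biclique c r≡j)
          (cong₂ sgn (proj₁ (same-cn c r≡j 0<w)) (proj₂ (same-cn c r≡j 0<w)))))
        (signed-weight (weight C D y z)))) (0≤weight C D y z)

  first second : (Fin (n ℕ.+ n) → ℚ) → Fin n → ℚ
  first  t v = t (v ↑ˡ n)
  second t v = t (n ↑ʳ v)

  f : Fin k → (Fin (n ℕ.+ n) → ℚ) → ℚ
  f j t = F j (excess (first t) (second t)) (excess (second t) (first t))

  f-tame : ∀ j → Tame (f j)
  f-tame j = tame-∑ₛ (λ A → tame-∑ₛ (λ B → tame-* (tame-const (coefficient j A B))
    (tame-weight A B (tame-excess first-tame second-tame) (tame-excess second-tame first-tame))))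
    where
    first-tame : ∀ v → Tame (λ t → first t v)
    first-tame v = tame-coord (v ↑ˡ n)
    second-tame : ∀ v → Tame (λ t → second t v)
    second-tame v = tame-coord (n ↑ʳ v)

  f-odd : ∀ j t → f j (t ∘ swapCopies) ≡ - f j t
  f-odd j t = trans
    (F-cong j (excess-cong first-swap second-swap) (excess-cong second-swap first-swap))
    (F-antisym j (excess (first t) (second t)) (excess (second t) (first t)))
    where
    first-swap : ∀ v → first (t ∘ swapCopies) v ≡ second t v
    first-swap v = cong (t ∘ join n n ∘ Sum.swap) (splitAt-↑ˡ n v n)
    second-swap : ∀ v → second (t ∘ swapCopies) v ≡ first t v
    second-swap v = cong (t ∘ join n n ∘ Sum.swap) (splitAt-↑ʳ n n v)

  private
    -- K levels, one more than there are values of excess, force a gap between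
    -- two consecutive ones; the 6 pays for the loss in excess-large.
    K N : ℕ
    K = suc (n ℕ.+ n)
    N = K ℕ.+ (n ℕ.+ n) ℕ.* (6 ℕ.+ K)


  module _ {δ : ℚ} (0<δ : 0ℚ < δ) (δ+Nδ≡1 : suc N · δ ≡ 1ℚ) where
    private
      0≤δ : 0ℚ ≤ δ
      0≤δ = ℚ.<⇒≤ 0<δ

    -- Both suprema are nonnegative by their default value, so each of the 2n coordinates is at most
    -- `a + b`. If the claim failed, their sum would stay below `N · δ`, which is `1ℚ - δ`.
    max-sum-large : ∀ t → 1ℚ - δ ≤ ∑ t → (6 ℕ.+ K) · δ ≤ supremum ⊤ (first t) + supremum ⊤ (second t)
    max-sum-large t 1-δ≤∑ with (6 ℕ.+ K) · δ ℚ.≤? supremum ⊤ (first t) + supremum ⊤ (second t)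
    ... | yes ≤ = ≤
    ... | no ≰  = contradiction (begin-strict
      (n ℕ.+ n) · (6 ℕ.+ K) · δ         ≡⟨ ·-* (n ℕ.+ n) (6 ℕ.+ K) δ ⟨
      ((n ℕ.+ n) ℕ.* (6 ℕ.+ K)) · δ     <⟨ below ⟩
      N · δ                             ≡⟨ lemma δ (N · δ) ⟩
      suc N · δ - δ                     ≡⟨ cong (_- δ) δ+Nδ≡1 ⟩
      1ℚ - δ                            ≤⟨ 1-δ≤∑ ⟩
      ∑ t                               ≤⟨ ∑≤· t (λ v → subst (λ v → t v ≤ a + b) (join-splitAt n n v) (t≤ (splitAt n v))) ⟩
      (n ℕ.+ n) · (a + b)               ≤⟨ ·-monoʳ (n ℕ.+ n) (ℚ.<⇒≤ (ℚ.≰⇒> ≰)) ⟩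
      (n ℕ.+ n) · (6 ℕ.+ K) · δ         ∎) (ℚ.<-irrefl refl)
      where
      open ℚ.≤-Reasoning
      open +-*-Solver
      a b : ℚ
      a = supremum ⊤ (first t)
      b = supremum ⊤ (second t)
      below : ((n ℕ.+ n) ℕ.* (6 ℕ.+ K)) · δ < N · δ
      below = ℚ.≤-<-trans (·-monoˡ 0≤δ (ℕ.m≤n+m _ (n ℕ.+ n)))
        (subst (_< N · δ) (ℚ.+-identityˡ _) (ℚ.+-monoˡ-< _ 0<δ))
      lemma : ∀ p q → q ≡ (p + q) - p
      lemma = solve 2 (λ p q → q := (p :+ q) :- p) refl
      t≤ : ∀ v → t (join n n v) ≤ a + b
      t≤ (inj₁ v) = ℚ.≤-trans (supremum-upper ⊤ (first t) ∈⊤)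
        (subst (_≤ a + b) (ℚ.+-identityʳ a) (ℚ.+-monoʳ-≤ a (0≤supremum ⊤ (second t))))
      t≤ (inj₂ v) = ℚ.≤-trans (supremum-upper ⊤ (second t) ∈⊤)
        (subst (_≤ a + b) (ℚ.+-identityˡ b) (ℚ.+-monoˡ-≤ b (0≤supremum ⊤ (first t))))


    private
      Kδ≤ : ∀ {c} → (6 ℕ.+ K) · δ ≤ c → K · δ ≤ c - 6 · δ
      Kδ≤ {c} ≤c = subst (_≤ c - 6 · δ)
        (trans (cong (_- 6 · δ) (·-+ 6 K δ)) (lemma (6 · δ) (K · δ)))
        (ℚ.+-monoˡ-≤ (- (6 · δ)) ≤c)
        where
        open +-*-Solver
        lemma : ∀ p q → (p + q) - p ≡ q
        lemma = solve 2 (λ p q → (p :+ q) :- p := q) refl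

      Kδ≤1 : K · δ ≤ 1ℚ
      Kδ≤1 = ℚ.≤-trans (·-monoˡ 0≤δ (ℕ.≤-trans (ℕ.m≤m+n K _) (ℕ.n≤1+n N))) (ℚ.≤-reflexive δ+Nδ≡1)

    -- The hypotheses are what late approximations of a point supported on `A ++ B` satisfy. After
    -- the loss of `6 · δ`, both excess functions still reach `K · δ`, so `Gap` finds a heavy
    -- biclique, in general other than `A`, `B`.
    f-large : ∀ t {A B} → ∃ (CN A) → ∃ (CN B) → A ⊆ cn B →
              (∀ v → - δ ≤ t v) → 1ℚ - δ ≤ ∑ t → (∀ v → v ∉ A ++ B → t v ≤ δ) →
              ∃ λ j → δ ≤ ∣ f j t ∣
    f-large t {A} {B} ∃CNA ∃CNB A⊆cnB -δ≤t 1-δ≤∑ t≤δ =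
      let v , v-large = excess-large 0≤δ A⊆cnB ∃CNB (λ v → -δ≤t (v ↑ˡ n)) first≤ second≤
          w , w-large = excess-large 0≤δ (⊆cn-sym A⊆cnB) ∃CNA (λ v → -δ≤t (n ↑ʳ v)) second≤ first≤
          C , D , C-D , δ≤weight = Gap.heavy-biclique 0<δ K (ℕ.n<1+n (n ℕ.+ n)) Kδ≤1
            (v , ℚ.≤-trans (Kδ≤ large) v-large)
            (w , ℚ.≤-trans (Kδ≤ (subst ((6 ℕ.+ K) · δ ≤_) (ℚ.+-comm (supremum ⊤ (first t)) _) large)) w-large)
            (excess-adjacent (first t) (second t))
      in F-large 0<δ C-D δ≤weight
      where
      large : (6 ℕ.+ K) · δ ≤ supremum ⊤ (first t) + supremum ⊤ (second t)
      large = max-sum-large t 1-δ≤∑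
      first≤ : ∀ v → v ∉ A → first t v ≤ δ
      first≤ v v∉A = t≤δ (v ↑ˡ n) (λ v∈ → v∉A
        (lookup⇒[]= v A (trans (sym (lookup-++ˡ A B v)) ([]=⇒lookup v∈))))
      second≤ : ∀ v → v ∉ B → second t v ≤ δ
      second≤ v v∉B = t≤δ (n ↑ʳ v) (λ v∈ → v∉B
        (lookup⇒[]= v B (trans (sym (lookup-++ʳ A B v)) ([]=⇒lookup v∈))))

    -- `δ` is fixed by the number of nodes, independently of `x`, as `ToSphere` requires. For
    -- `k = 0` no `j` exists, so the realization is empty, like the sphere it is mapped to.
    f-nonzero : ∀ x → InRealization box x → Eventually (λ i → ∃ λ j → δ ≤ ∣ f j (approx x i) ∣)
    f-nonzero x (0≤x , Σx≈1 , _ , (A , B , refl , ∃CNA , ∃CNB , A⊆CNB , _) , supported) =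
      eventually-zip (λ i (-δ<x , x<δ) Σx → f-large (approx x i) ∃CNA ∃CNB (∈-cn⁺ ∘ A⊆CNB)
          (λ v → ℚ.<⇒≤ (-δ<x v)) Σx (λ v v∉ → ℚ.<⇒≤ (x<δ v v∉)))
        (eventually-zip (λ _ → _,_) (eventually-all lower) (eventually-all upper)) total
      where
      open +-*-Solver
      lower : ∀ v → Eventually (λ i → - δ < approx x i v)
      lower v = eventually-map (λ i 0-x<δ → subst (- δ <_) (lemma (approx x i v)) (ℚ.neg-antimono-< 0-x<δ))
        (0≤x v δ 0<δ)
        where
        lemma : ∀ p → - (0ℚ - p) ≡ p
        lemma = solve 1 (λ p → :- (con 0ℚ :- p) := p) refl

      upper : ∀ v → Eventually (λ i → v ∉ A ++ B → approx x i v < δ)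
      upper v with v ∈? A ++ B
      ... | yes v∈ = 0 , λ _ _ v∉ → contradiction v∈ v∉
      ... | no v∉  = eventually-map
        (λ i ∣x-0∣<δ _ → ℚ.≤-<-trans (p≤∣p∣ (approx x i v))
          (subst (λ p → ∣ p ∣ < δ) (ℚ.+-identityʳ (approx x i v)) ∣x-0∣<δ))
        (supported v v∉ δ 0<δ)

      total : Eventually (λ i → 1ℚ - δ ≤ ∑ (approx x i))
      total = eventually-map (λ i ∣Σ-1∣<δ → ℚ.<⇒≤ (subst (1ℚ - δ <_) (lemma (∑ (approx x i)))
          (ℚ.+-monoʳ-< 1ℚ (ℚ.neg-antimono-< (ℚ.≤-<-trans (p≤∣p∣ (1ℚ - ∑ (approx x i)))
            (subst (_< δ) (dist-sym (∑ (approx x i)) 1ℚ)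
              (subst (λ s → ∣ s - 1ℚ ∣ < δ) (seq-sum x i) ∣Σ-1∣<δ)))))))
        (Σx≈1 δ 0<δ)
        where
        lemma : ∀ p → 1ℚ - (1ℚ - p) ≡ p
        lemma = solve 1 (λ p → con 1ℚ :- (con 1ℚ :- p) := p) refl

  boxMap : ℤ₂-Map boxSpace (UnitSphere k)
  boxMap =
    let δ , 0<δ , δ+Nδ≡1 = unit-fraction N
    in ToSphere.toSphere box box-involution f f-tame f-odd 0<δ (f-nonzero 0<δ δ+Nδ≡1)

  boxMapsToSphere : MapsToSphere boxSpace (k ⊖ 1)
  boxMapsToSphere = k , refl , boxMap

-- The bound on the index

open import Data.Integer.Base using (+_; _+_; _-_; _⊖_)
import Data.Integer.Properties as ℤ
open import Data.Nat.Base as ℕ using (suc; _∸_)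
import Data.Nat.Properties as ℕ
open import Data.Product.Base using (_,_)
open import Relation.Binary.PropositionalEquality using (_≡_; sym; trans; subst)

-- As `ℓ` and `m` are positive, the truncated subtraction of 2 is exact. The case `ℓ = m = 1` gives
-- -1, the dimension of the empty sphere.
[ℓ+m∸2]⊖1≡ℓ+m-3 : ∀ {ℓ m} → ℓ ≥ 1 → m ≥ 1 → (ℓ ℕ.+ m ∸ 2) ⊖ 1 ≡ + ℓ + + m - + 3
[ℓ+m∸2]⊖1≡ℓ+m-3 {suc ℓ} {suc m} _ _ rewrite ℕ.+-suc ℓ m = sym (trans
  (ℤ.[1+m]⊖[1+n]≡m⊖n (suc (ℓ ℕ.+ m)) 2) (ℤ.[1+m]⊖[1+n]≡m⊖n (ℓ ℕ.+ m) 1))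

theorem1 : (G : Graph) → Graph.Connected G →
    (ℓ m : ℕ) → ℓ ≥ 1 → m ≥ 1 →
    ¬ Graph.ContainsK G ℓ m →
    ind Graph.boxSpace G ≤ (+ ℓ + + m - + 3)
theorem1 G _ ℓ m ℓ≥1 m≥1 ¬K =
  (ℓ ℕ.+ m ∸ 2) ⊖ 1 , ℤ.≤-reflexive ([ℓ+m∸2]⊖1≡ℓ+m-3 ℓ≥1 m≥1) ,
  Coordinates.boxMapsToSphere G ℓ m ℓ≥1 m≥1 ¬K
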